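{- For every integer $n\ge 3$ there exist constants $C=C(n)<\infty$ and $\theta=\theta(n)\in(0,1)$, independent of $m$, such that the following holds for every integer $m\ge 2$. Sample a uniform spanning tree $T$ of $G_{n,m}=C_n\times P_m$ by Wilson's algorithm, with the root being a vertex of one of the two boundary rings $R_0,R_{m-1}$ and with the first random walk started from a vertex of the other boundary ring, and let $L\subset T$ be the first loop-erased path produced by the algorithm. Then for every fixed vertex $v\in V(G_{n,m})$ and every integer $l\ge 0$, $$\mathbb P\bigl(d_T(v,L)\ge l\bigr)\le C\,\theta^{\,l}.$$
   Context: For $n\ge 3$, $m\ge 2$, the cylindrical graph $G_{n,m}=C_n\times P_m$ has vertex set $\{(i,j): i\in\mathbb{Z}_n,\ j\in\{0,\dots,m-1\}\}$ and edges $\{(i,j),(i+1,j)\}$ ($i\in\mathbb{Z}_n$, $0\le j\le m-1$) and $\{(i,j),(i,j+1)\}$ ($i\in\mathbb{Z}_n$, $0\le j\le m-2$). Its rings are $R_k=\{(i,k): i\in\mathbb{Z}_n\}$, $k=0,\dots,m-1$; the boundary rings are $R_0$ and $R_{m-1}$. Loop-erasure: for a finite path $\gamma$, its (chronological) loop-erasure is obtained by iteratively erasing cycles in chronological order: whenever the path first revisits a vertex, delete the loop formed between the two occurrences. Wilson's algorithm on a finite connected graph $G=(V,E)$: choose a root $r\in V$ and an ordering of $V\setminus\{r\}$. Starting with the tree $\{r\}$, repeatedly take the first vertex in the ordering not yet in the current tree, run (independently of the past) simple random walk from it (each step moves to a uniformly chosen neighbour) until it first hits the current tree, and add the loop-erasure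 of this walk to the tree. The final tree is a uniform spanning tree (uniformly distributed among all spanning trees). $d_T$ denotes graph distance in $T$, and $d_T(v,L)=\min_{u\in V(L)} d_T(v,u)$. -}

module Defs where

open import Level using (0ℓ)
open import Data.Nat as ℕ using (ℕ; zero; suc; _∸_; _%_)
open import Data.Nat.Properties as ℕₚ using ()
open import Data.Integer using (+_)
open import Data.Rational using (ℚ; 0ℚ; _+_; _*_; _/_; _≤_; +-*-rawSemiring)
open import Algebra.Definitions.RawSemiring +-*-rawSemiring public using (_^_)
open import Data.Fin as Fin using (Fin; toℕ)
open import Data.Fin.Properties as Finₚ using (nonZeroIndex)
open import Data.List using (List; []; _∷_; map; concat; concatMap; filter; foldl; foldr; reverse; dropWhile; zip; drop; length; _++_; allFin; cartesianProduct)
open import Data.List.Membership.Propositional using (_∈_; find; lose)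
open import Data.List.Membership.Propositional.Properties using (∈-allFin; ∈-cartesianProduct⁺)
import Data.List.Membership.DecPropositional as DecMembership
open import Data.List.Relation.Unary.Any using (any?)
open import Data.List.Relation.Unary.Unique.Propositional using (Unique)
open import Data.List.Relation.Unary.Unique.Propositional.Properties using (allFin⁺; cartesianProduct⁺)
open import Data.List.Relation.Binary.Permutation.Propositional using (_↭_)
open import Data.Maybe using (Maybe; just; nothing)
import Data.Maybe.Relation.Unary.Any as Maybe
open import Data.Product using (∃-syntax; _×_; _,_; proj₁; proj₂)
open import Data.Product.Properties using (≡-dec)
open import Data.Sum using (_⊎_; inj₁; inj₂; swap)
open import Function using (_∘_)
open import Relation.Binary using (Rel; Decidable; DecidableEquality; Symmetric)
open import Relation.Binary.PropositionalEquality using (_≡_; refl; sym)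
open import Relation.Nullary using (Dec; yes; no; ¬?)
open import Relation.Nullary.Decidable using (map′; _×-dec_; _⊎-dec_)
open import Relation.Unary using (Pred) renaming (Decidable to Decidable₁)

------------------------------------------------------------------------
-- Finitely supported distributions with rational weights

Dist : Set → Set
Dist A = List (ℚ × A)

return : ∀ {A} → A → Dist A
return a = (+ 1 / 1 , a) ∷ []

infixl 1 _>>=_
_>>=_ : ∀ {A B} → Dist A → (A → Dist B) → Dist B
d >>= f = concatMap (λ (p , a) → map (λ (q , b) → (p * q , b)) (f a)) d

-- The empty list carries no distribution; the value there is a dummy, used
-- only if a random walk has to step from an isolated vertex.
uniform : ∀ {A} → List A → Dist A
uniform []           = []
uniform xs@(_ ∷ _) = map (λ a → (+ 1 / length xs , a)) xs

prob : ∀ {A} {E : Pred A 0ℓ} → Decidable₁ E → Dist A → ℚ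
prob E? d = foldr _+_ 0ℚ (map proj₁ (filter (E? ∘ proj₂) d))

------------------------------------------------------------------------
-- Least elements of predicates on ℕ

IsLeast : Pred ℕ 0ℓ → Pred ℕ 0ℓ
IsLeast P d = P d × (∀ k → P k → d ℕ.≤ k)

lowerBound? : ∀ {P : Pred ℕ 0ℓ} → Decidable₁ P → ∀ d → Dec (∀ k → P k → d ℕ.≤ k)
lowerBound? {P} P? d =
  map′ (λ h k pk → ℕₚ.≮⇒≥ λ k<d → h k<d pk)
       (λ h {k} k<d pk → ℕₚ.<⇒≱ k<d (h k pk))
       (ℕₚ.allUpTo? (¬? ∘ P?) d)

isLeast? : ∀ {P : Pred ℕ 0ℓ} → Decidable₁ P → Decidable₁ (IsLeast P)
isLeast? P? d = P? d ×-dec lowerBound? P? d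

------------------------------------------------------------------------
-- Graphs

record FiniteGraph : Set₁ where
  infix 4 _≟_ _~_ _~?_
  field
    V        : Set
    _≟_      : DecidableEquality V
    vertices : List V
    complete : ∀ v → v ∈ vertices
    unique   : Unique vertices
    _~_      : Rel V 0ℓ
    _~?_     : Decidable _~_
    ~-sym    : Symmetric _~_

  neighbours : V → List V
  neighbours v = filter (v ~?_) vertices

data Walk {V : Set} (_~_ : Rel V 0ℓ) : ℕ → Rel V 0ℓ where
  []  : ∀ {v} → Walk _~_ 0 v v
  _∷_ : ∀ {k u v w} → u ~ v → Walk _~_ k v w → Walk _~_ (suc k) u w

module Wilson (G : FiniteGraph) where
  open FiniteGraph G
  open DecMembership _≟_ using (_∈?_)

  -- The self-avoiding path built so far is stored with its last vertex first.
  -- When x is revisited, everything added after the earlier x is discarded.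
  extend : List V → V → List V
  extend π x with x ∈? π
  ... | yes _ = dropWhile (λ y → ¬? (y ≟ x)) π
  ... | no  _ = x ∷ π

  loopErasure : List V → List V
  loopErasure γ = reverse (foldl extend [] γ)

  -- The branches are the loop-erased paths in the order in which the algorithm
  -- added them, each written from its starting vertex to its hitting point.
  record Tree : Set where
    constructor tree
    field
      root     : V
      branches : List (List V)

    treeVertices : List V
    treeVertices = root ∷ concat branches

    edges : List (V × V)
    edges = concatMap (λ π → zip π (drop 1 π)) branches

    -- dummy value [] before the first branch has been added
    firstPath : List V
    firstPath = firstOf branches
      where
      firstOf : List (List V) → List V
      firstOf []      = []
      firstOf (π ∷ _) = π

    infix 4 _~ᵀ_
    _~ᵀ_ : Rel V 0ℓ
    u ~ᵀ w = (u , w) ∈ edges ⊎ (w , u) ∈ edges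

  open Tree public

  addBranch : Tree → List V → Tree
  addBranch t π = tree (root t) (branches t ++ π ∷ [])

  -- N bounds the total number of random-walk steps still allowed; the outcome
  -- is nothing when the algorithm has not finished within this bound.
  -- The argument γ of walk is the trajectory so far, in reverse order.
  mutual
    grow : ℕ → Tree → List V → Dist (Maybe Tree)
    grow N t []       = return (just t)
    grow N t (x ∷ xs) with x ∈? treeVertices t
    ... | yes _ = grow N t xs
    ... | no  _ = walk N t x (x ∷ []) xs

    walk : ℕ → Tree → V → List V → List V → Dist (Maybe Tree)
    walk zero    t x γ xs = return nothing
    walk (suc N) t x γ xs = uniform (neighbours x) >>= λ y → arrive N t y (y ∷ γ) xs

    arrive : ℕ → Tree → V → List V → List V → Dist (Maybe Tree)
    arrive N t y γ xs with y ∈? treeVertices t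
    ... | yes _ = grow N (addBranch t (loopErasure (reverse γ))) xs
    ... | no  _ = walk N t y γ xs

  IsOrdering : V → List V → Set
  IsOrdering r xs = r ∷ xs ↭ vertices

  wilson : V → List V → ℕ → Dist (Maybe Tree)
  wilson r xs N = grow N (tree r []) xs

  -- The events "finished within N steps, and E holds for the outcome" increase
  -- with N to the event that E holds for the tree produced by the algorithm,
  -- so the probability of the latter, a real number, is the supremum of these
  -- rationals, and it is at most q exactly when all of them are.
  ℙWilson≤ : V → List V → {E : Pred Tree 0ℓ} → Decidable₁ E → ℚ → Set
  ℙWilson≤ r xs E? q = ∀ N → prob (Maybe.dec E?) (wilson r xs N) ≤ q

  IsDistance : Tree → V → V → ℕ → Set
  IsDistance t v u = IsLeast (λ k → Walk (_~ᵀ_ t) k v u)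

  IsDistanceTo : Tree → V → List V → ℕ → Set
  IsDistanceTo t v L = IsLeast (λ k → ∃[ u ] u ∈ L × IsDistance t v u k)

  -- d_T(v , L) ≥ l for the first loop-erased path L
  FarFromFirstPath : V → ℕ → Tree → Set
  FarFromFirstPath v l t = ∀ d → IsDistanceTo t v (firstPath t) d → l ℕ.≤ d

  _~ᵀ?_ : ∀ {t} → Decidable (_~ᵀ_ t)
  _~ᵀ?_ {t} u w = (u , w) ∈ᵉ? edges t ⊎-dec (w , u) ∈ᵉ? edges t
    where open DecMembership (≡-dec _≟_ _≟_) renaming (_∈?_ to _∈ᵉ?_)

  walk? : ∀ {_~′_ : Rel V 0ℓ} → Decidable _~′_ → ∀ k → Decidable (Walk _~′_ k)
  walk? R? zero    u w = map′ (λ { refl → [] }) (λ { [] → refl }) (u ≟ w)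
  walk? R? (suc k) u w =
    map′ (λ a → let (v , _ , s) = find a in proj₁ s ∷ proj₂ s)
         (λ { (r ∷ p) → lose (complete _) (r , p) })
         (any? (λ v → R? u v ×-dec walk? R? k v w) vertices)

  isDistance? : ∀ t v u → Decidable₁ (IsDistance t v u)
  isDistance? t v u = isLeast? (λ k → walk? (_~ᵀ?_ {t}) k v u)

  isDistanceTo? : ∀ t v L → Decidable₁ (IsDistanceTo t v L)
  isDistanceTo? t v L = isLeast? λ k →
    map′ find (λ (_ , u∈L , δ) → lose u∈L δ)
         (any? (λ u → isDistance? t v u k) L)

  farFromFirstPath? : ∀ v l → Decidable₁ (FarFromFirstPath v l)
  farFromFirstPath? v l t = lowerBound? (isDistanceTo? t v (firstPath t)) l

open Wilson public using (IsOrdering; ℙWilson≤; FarFromFirstPath; farFromFirstPath?)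

------------------------------------------------------------------------
-- The cylinder Cₙ × Pₘ

Cyl : ℕ → ℕ → Set
Cyl n m = Fin n × Fin m

-- i′ = i + 1 in ℤ/n
CycleStep : ∀ {n} → Rel (Fin n) 0ℓ
CycleStep {n} i i′ = toℕ i′ ≡ (suc (toℕ i) % n) {{nonZeroIndex i}}

PathStep : ∀ {m} → Rel (Fin m) 0ℓ
PathStep j j′ = toℕ j′ ≡ suc (toℕ j)

CylAdj : ∀ {n m} → Rel (Cyl n m) 0ℓ
CylAdj (i , j) (i′ , j′) =
    (j ≡ j′ × (CycleStep i i′ ⊎ CycleStep i′ i))
  ⊎ (i ≡ i′ × (PathStep j j′ ⊎ PathStep j′ j))

cylAdj? : ∀ {n m} → Decidable (CylAdj {n} {m})
cylAdj? (i , j) (i′ , j′) =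
        (j Finₚ.≟ j′ ×-dec (toℕ i′ ℕ.≟ _ ⊎-dec toℕ i ℕ.≟ _))
  ⊎-dec (i Finₚ.≟ i′ ×-dec (toℕ j′ ℕ.≟ _ ⊎-dec toℕ j ℕ.≟ _))

cylAdj-sym : ∀ {n m} → Symmetric (CylAdj {n} {m})
cylAdj-sym (inj₁ (e , s)) = inj₁ (sym e , swap s)
cylAdj-sym (inj₂ (e , s)) = inj₂ (sym e , swap s)

cylinder : ℕ → ℕ → FiniteGraph
cylinder n m = record
  { V        = Cyl n m
  ; _≟_      = ≡-dec Finₚ._≟_ Finₚ._≟_
  ; vertices = cartesianProduct (allFin n) (allFin m)
  ; complete = λ (i , j) → ∈-cartesianProduct⁺ (∈-allFin i) (∈-allFin j)
  ; unique   = cartesianProduct⁺ (allFin⁺ n) (allFin⁺ m)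
  ; _~_      = CylAdj
  ; _~?_     = cylAdj?
  ; ~-sym    = cylAdj-sym
  }

InRing : ∀ {n m} → ℕ → Cyl n m → Set
InRing k (_ , j) = toℕ j ≡ k

OppositeBoundaryRings : ∀ {n m} → Rel (Cyl n m) 0ℓ
OppositeBoundaryRings {m = m} r s =
    (InRing 0 r × InRing (m ∸ 1) s)
  ⊎ (InRing (m ∸ 1) r × InRing 0 s)

{-# OPTIONS --safe #-}

-- Orient every edge towards the first path L, and call a ring good if each vertex of
-- the ring outside L points to its cyclic successor in the ring. A route to L cannot
-- cross a good ring, since it runs along the ring from its first visit until it meets L,
-- which passes through all rings. So d(v , L) is large only if one of two long blocks of
-- rings, just above and just below v, contains no good ring.
--
-- The probability of that is bounded for every ordering at once: when a walk first
-- enters a ring, with probability bounded below it follows the ring until it hits the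
-- tree. Precisely, the product over a block of the factors 1 - ε ^ c (1 for a ring already
-- spoilt), where c counts the vertices of the ring without an outgoing edge and 1 / ε
-- bounds the degrees, is a supermartingale, and a good ring has the factor 0 in the end.
module Submission where

open import Defs
open import Data.Bool using (true; false)
open import Data.Fin using (Fin; toℕ; fromℕ<)
open import Data.Fin.Properties using (toℕ-fromℕ<; toℕ-injective; toℕ<n)
import Data.Integer as ℤ
import Data.Integer.Properties as ℤₚ
open import Data.List using (List; _∷_; []; _++_; _∷ʳ_; map; concat; concatMap; length; zip; drop; dropWhile; reverse; filter; foldl; upTo; allFin; cartesianProduct)
open import Data.List.Properties using (length-++; length-map; length-upTo; length-tabulate; unfold-reverse; foldl-∷ʳ; concat-++; concatMap-++; ++-identityʳ)
import Data.List.Membership.DecPropositional as DecMembership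
open import Data.List.Membership.Propositional using (_∈_; _∉_; find; lose)
open import Data.List.Membership.Propositional.Properties using (∈-∃++; ∈-++⁺ˡ; ∈-++⁺ʳ; ∈-++⁻; ∈-filter⁺; ∈-filter⁻; ∈-allFin; ∈-cartesianProduct⁺; ∈-map⁻; ∈-map⁺; ∈-upTo⁺)
open import Data.List.Relation.Binary.Permutation.Propositional using (↭-sym)
open import Data.List.Relation.Binary.Permutation.Propositional.Properties using (∈-resp-↭)
open import Data.List.Relation.Unary.All as All using (All; []; _∷_)
open import Data.List.Relation.Unary.AllPairs using ([]; _∷_)
open import Data.List.Relation.Unary.Any using (here; there; any?)
open import Data.List.Relation.Unary.Any.Properties using (reverse⁺; reverse⁻)
open import Data.List.Relation.Unary.Unique.Propositional using (Unique)
import Data.List.Relation.Unary.Unique.Propositional.Properties as Unique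
open import Data.Maybe using (just)
import Data.Maybe.Relation.Unary.Any as Maybe
open import Data.Nat as ℕ using (ℕ; zero; suc; s≤s; z≤n)
import Data.Nat.DivMod as ℕ
import Data.Nat.Properties as ℕₚ
import Data.Nat.Solver
open import Data.Product using (Σ-syntax; _×_; _,_; proj₁; proj₂; ∃-syntax; ∃₂)
open import Data.Rational using (ℚ; 0ℚ; 1ℚ; _+_; _-_; -_; _*_; _<_; _≤_; _/_; nonNegative; positive; toℚᵘ; +-*-rawSemiring)
open import Data.Rational.Properties using (*-assoc; *-cancelˡ-<-nonNeg; *-comm; *-distribʳ-+; *-distribˡ-+; *-identityˡ; *-monoʳ-<-pos; *-monoʳ-≤-nonNeg; *-monoˡ-≤-nonNeg; *-zeroʳ; *-zeroˡ; +-assoc; +-identityʳ; +-identityˡ; +-inverseʳ; +-mono-≤; +-monoʳ-<; +-monoʳ-≤; +-monoˡ-≤; 0/n≡0; <-≤-trans; <⇒≤; fromℚᵘ-cong; neg-antimono-<; neg-antimono-≤; nonNegative⁻¹; normalize-nonNeg; normalize-pos; positive⁻¹; toℚᵘ-fromℚᵘ; toℚᵘ-homo-+; toℚᵘ-injective; ≤-refl; ≤-reflexive; ≤-trans; module ≤-Reasoning)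
open import Data.Rational.Solver using (module +-*-Solver)
import Data.Rational.Unnormalised as ℚᵘ
import Data.Rational.Unnormalised.Properties as ℚᵘₚ
open import Algebra.Definitions.RawSemiring +-*-rawSemiring using () renaming (_×_ to _·_)
open import Data.Sum using (_⊎_; inj₁; inj₂; [_,_]′)
open import Function using (_∘_)
open import Level using (0ℓ)
open import Relation.Binary.PropositionalEquality
open import Relation.Nullary using (Dec; does; yes; no; ¬_; ¬?; contradiction)
open import Relation.Nullary.Decidable using (map′; _×-dec_; _→-dec_)
open import Relation.Unary using (Pred) renaming (Decidable to Decidable₁)

module ℕSolver = Data.Nat.Solver.+-*-Solver

-- Order, natural multiples and powers of rationals

infix 4 _≥0
_≥0 : ℚ → Set
p ≥0 = 0ℚ ≤ p

*-monoˡ : ∀ {r p q} → r ≥0 → p ≤ q → r * p ≤ r * q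
*-monoˡ {r} r≥0 = *-monoˡ-≤-nonNeg r {{nonNegative r≥0}}

*-monoʳ : ∀ {r p q} → r ≥0 → p ≤ q → p * r ≤ q * r
*-monoʳ {r} r≥0 = *-monoʳ-≤-nonNeg r {{nonNegative r≥0}}

*-mono : ∀ {p q r s} → q ≥0 → r ≥0 → p ≤ q → r ≤ s → p * r ≤ q * s
*-mono q≥0 r≥0 p≤q r≤s = ≤-trans (*-monoʳ r≥0 p≤q) (*-monoˡ q≥0 r≤s)

*≥0 : ∀ {p q} → p ≥0 → q ≥0 → (p * q) ≥0
*≥0 {p} {q} p≥0 q≥0 = subst (_≤ p * q) (*-zeroʳ p) (*-monoˡ p≥0 q≥0)

+≥0 : ∀ {p q} → p ≥0 → q ≥0 → (p + q) ≥0
+≥0 = +-mono-≤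

-≥0 : ∀ {p q} → p ≤ q → (q - p) ≥0
-≥0 {p} {q} p≤q = subst (_≤ q - p) (+-inverseʳ p) (+-monoˡ-≤ (- p) p≤q)

1≥0 : 1ℚ ≥0
1≥0 = nonNegative⁻¹ 1ℚ

·-≥0 : ∀ k {p} → p ≥0 → (k · p) ≥0
·-≥0 zero    p≥0 = ≤-refl
·-≥0 (suc k) p≥0 = +≥0 p≥0 (·-≥0 k p≥0)

·-mono : ∀ {j k p} → p ≥0 → j ℕ.≤ k → j · p ≤ k · p
·-mono {k = k} p≥0 ℕ.z≤n = ·-≥0 k p≥0
·-mono {p = p} p≥0 (ℕ.s≤s j≤k) = +-monoʳ-≤ p (·-mono p≥0 j≤k)

·-monoʳ : ∀ k {p q} → p ≤ q → k · p ≤ k · q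
·-monoʳ zero    p≤q = ≤-refl
·-monoʳ (suc k) p≤q = +-mono-≤ p≤q (·-monoʳ k p≤q)

·-zero : ∀ k → k · 0ℚ ≡ 0ℚ
·-zero zero    = refl
·-zero (suc k) = trans (+-identityˡ _) (·-zero k)

·-assoc-* : ∀ k p q → (k · p) * q ≡ k · (p * q)
·-assoc-* zero    p q = *-zeroˡ q
·-assoc-* (suc k) p q = trans (*-distribʳ-+ q p (k · p)) (cong (_+_ (p * q)) (·-assoc-* k p q))

·-distrib-+ : ∀ k p q → k · (p + q) ≡ k · p + k · q
·-distrib-+ zero    p q = refl
·-distrib-+ (suc k) p q = trans (cong (_+_ (p + q)) (·-distrib-+ k p q))
  (solve 4 (λ a b c d → a :+ b :+ (c :+ d) := a :+ c :+ (b :+ d)) refl p q (k · p) (k · q))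
  where open +-*-Solver

-- The induction step is computed with unnormalised fractions, where adding two fractions of equal
-- denominator is a cross-multiplication.
·-unit : ∀ k d → k · (ℤ.+ 1 / suc d) ≡ ℤ.+ k / suc d
·-unit zero    d = sym (0/n≡0 (suc d))
·-unit (suc k) d = trans (cong (_+_ (ℤ.+ 1 / suc d)) (·-unit k d)) (toℚᵘ-injective (begin-equality
  toℚᵘ (ℤ.+ 1 / suc d + ℤ.+ k / suc d)             ≃⟨ toℚᵘ-homo-+ (ℤ.+ 1 / suc d) (ℤ.+ k / suc d) ⟩
  toℚᵘ (ℤ.+ 1 / suc d) ℚᵘ.+ toℚᵘ (ℤ.+ k / suc d)   ≃⟨ ℚᵘₚ.+-cong (toℚᵘ-fromℚᵘ (ℚᵘ.mkℚᵘ (ℤ.+ 1) d)) (toℚᵘ-fromℚᵘ (ℚᵘ.mkℚᵘ (ℤ.+ k) d)) ⟩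
  ℚᵘ.mkℚᵘ (ℤ.+ 1) d ℚᵘ.+ ℚᵘ.mkℚᵘ (ℤ.+ k) d         ≃⟨ ℚᵘ.*≡* (cross (ℤ.+ 1) (ℤ.+ k) (ℤ.+ suc d)) ⟩
  ℚᵘ.mkℚᵘ (ℤ.+ suc k) d                          ≃⟨ toℚᵘ-fromℚᵘ (ℚᵘ.mkℚᵘ (ℤ.+ suc k) d) ⟨
  toℚᵘ (ℤ.+ suc k / suc d) ∎))
  where
  open ℚᵘₚ.≤-Reasoning
  cross : ∀ a b c → (a ℤ.* c ℤ.+ b ℤ.* c) ℤ.* c ≡ (a ℤ.+ b) ℤ.* (c ℤ.* c)
  cross a b c = trans (cong (ℤ._* c) (sym (ℤₚ.*-distribʳ-+ c a b))) (ℤₚ.*-assoc (a ℤ.+ b) c c)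

suc·1/suc : ∀ d → suc d · (ℤ.+ 1 / suc d) ≡ 1ℚ
suc·1/suc d = trans (·-unit (suc d) d) (fromℚᵘ-cong {ℚᵘ.mkℚᵘ (ℤ.+ suc d) d} {ℚᵘ.1ℚᵘ} (ℚᵘ.*≡* (ℤₚ.*-comm (ℤ.+ suc d) (ℤ.+ 1))))

1/suc≥0 : ∀ d → (ℤ.+ 1 / suc d) ≥0
1/suc≥0 d = nonNegative⁻¹ _ {{normalize-nonNeg 1 (suc d)}}

1/suc>0 : ∀ d → 0ℚ < ℤ.+ 1 / suc d
1/suc>0 d = positive⁻¹ _ {{normalize-pos 1 (suc d)}}

1/suc≤1 : ∀ d → ℤ.+ 1 / suc d ≤ 1ℚ
1/suc≤1 d = subst₂ _≤_ (+-identityʳ _) (suc·1/suc d) (+-monoʳ-≤ (ℤ.+ 1 / suc d) (·-≥0 d (1/suc≥0 d)))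

^-≥0 : ∀ {p} k → p ≥0 → (p ^ k) ≥0
^-≥0 zero    p≥0 = 1≥0
^-≥0 (suc k) p≥0 = *≥0 p≥0 (^-≥0 k p≥0)

^-≤1 : ∀ {p} k → p ≥0 → p ≤ 1ℚ → p ^ k ≤ 1ℚ
^-≤1 zero    p≥0 p≤1 = ≤-refl
^-≤1 (suc k) p≥0 p≤1 = *-mono 1≥0 (^-≥0 k p≥0) p≤1 (^-≤1 k p≥0 p≤1)

^-mono : ∀ {p q} k → p ≥0 → p ≤ q → p ^ k ≤ q ^ k
^-mono zero    p≥0 p≤q = ≤-refl
^-mono (suc k) p≥0 p≤q = *-mono (≤-trans p≥0 p≤q) (^-≥0 k p≥0) p≤q (^-mono k p≥0 p≤q)

^-antimono : ∀ {p j k} → p ≥0 → p ≤ 1ℚ → j ℕ.≤ k → p ^ k ≤ p ^ j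
^-antimono {k = k} p≥0 p≤1 ℕ.z≤n       = ^-≤1 k p≥0 p≤1
^-antimono         p≥0 p≤1 (ℕ.s≤s j≤k) = *-monoˡ p≥0 (^-antimono p≥0 p≤1 j≤k)

^-+ : ∀ p j k → p ^ (j ℕ.+ k) ≡ p ^ j * p ^ k
^-+ p zero    k = sym (*-identityˡ _)
^-+ p (suc j) k = trans (cong (p *_) (^-+ p j k)) (sym (*-assoc p _ _))

^-* : ∀ p j k → p ^ (k ℕ.* j) ≡ (p ^ j) ^ k
^-* p j zero    = refl
^-* p j (suc k) = trans (^-+ p j (k ℕ.* j)) (cong (_*_ (p ^ j)) (^-* p j k))

^-distrib-* : ∀ p q k → (p * q) ^ k ≡ p ^ k * q ^ k
^-distrib-* p q zero    = refl
^-distrib-* p q (suc k) = trans (cong (_*_ (p * q)) (^-distrib-* p q k))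
  (solve 4 (λ a b c d → a :* b :* (c :* d) := a :* c :* (b :* d)) refl p q (p ^ k) (q ^ k))
  where open +-*-Solver

^-≥1 : ∀ {p} k → 1ℚ ≤ p → 1ℚ ≤ p ^ k
^-≥1 zero    1≤p = ≤-refl
^-≥1 (suc k) 1≤p = *-mono (≤-trans 1≥0 1≤p) 1≥0 1≤p (^-≥1 k 1≤p)

bernoulli : ∀ {x} k → x ≥0 → x ≤ 1ℚ → 1ℚ - k · x ≤ (1ℚ - x) ^ k
bernoulli zero    x≥0 x≤1 = ≤-refl
bernoulli {x} (suc k) x≥0 x≤1 = begin
  1ℚ - (x + k · x)                    ≡⟨ +-identityʳ _ ⟨
  -- Adding the nonnegative cross term `x * (k · x)` completes the product `(1 - x) * (1 - k · x)`.
  1ℚ - (x + k · x) + 0ℚ               ≤⟨ +-monoʳ-≤ (1ℚ - (x + k · x)) (*≥0 x≥0 (·-≥0 k x≥0)) ⟩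
  1ℚ - (x + k · x) + x * (k · x)      ≡⟨ solve 2 (λ a b → con 1ℚ :- (a :+ b) :+ a :* b := (con 1ℚ :- a) :* (con 1ℚ :- b)) refl x (k · x) ⟩
  (1ℚ - x) * (1ℚ - k · x)             ≤⟨ *-monoˡ (-≥0 x≤1) (bernoulli k x≥0 x≤1) ⟩
  (1ℚ - x) * (1ℚ - x) ^ k             ∎
  where
  open ≤-Reasoning
  open +-*-Solver

-- Sums and probabilities over lists

Σℚ : ∀ {A : Set} → (A → ℚ) → List A → ℚ
Σℚ f []       = 0ℚ
Σℚ f (x ∷ xs) = f x + Σℚ f xs

module _ {A : Set} where

  Σℚ-mono : ∀ {f g : A → ℚ} xs → (∀ {x} → x ∈ xs → f x ≤ g x) → Σℚ f xs ≤ Σℚ g xs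
  Σℚ-mono []       f≤g = ≤-refl
  Σℚ-mono (x ∷ xs) f≤g = +-mono-≤ (f≤g (here refl)) (Σℚ-mono xs (f≤g ∘ there))

  Σℚ-const : ∀ c (xs : List A) → Σℚ (λ _ → c) xs ≡ length xs · c
  Σℚ-const c []       = refl
  Σℚ-const c (x ∷ xs) = cong (c +_) (Σℚ-const c xs)

  Σℚ-+ : ∀ (f g : A → ℚ) xs → Σℚ (λ x → f x + g x) xs ≡ Σℚ f xs + Σℚ g xs
  Σℚ-+ f g []       = refl
  Σℚ-+ f g (x ∷ xs) = trans (cong (_+_ (f x + g x)) (Σℚ-+ f g xs))
    (solve 4 (λ a b c d → a :+ b :+ (c :+ d) := a :+ c :+ (b :+ d)) refl (f x) (g x) (Σℚ f xs) (Σℚ g xs))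
    where open +-*-Solver

  Σℚ-≤-slack : ∀ {f : A → ℚ} {M s z} xs → (∀ {x} → x ∈ xs → f x ≤ M) → z ∈ xs → f z + s ≤ M →
               Σℚ f xs + s ≤ length xs · M
  Σℚ-≤-slack {f} {M} {s} (x ∷ xs) f≤M (here refl) fz = begin
    f x + Σℚ f xs + s       ≡⟨ solve 3 (λ a b c → a :+ b :+ c := a :+ c :+ b) refl (f x) (Σℚ f xs) s ⟩
    f x + s + Σℚ f xs       ≤⟨ +-mono-≤ fz (Σℚ-mono xs (f≤M ∘ there)) ⟩
    M + Σℚ (λ _ → M) xs     ≡⟨ cong (_+_ M) (Σℚ-const M xs) ⟩
    M + length xs · M       ∎
    where
    open ≤-Reasoning
    open +-*-Solver
  Σℚ-≤-slack {f} {M} {s} (x ∷ xs) f≤M (there z∈) fz = begin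
    f x + Σℚ f xs + s       ≡⟨ +-assoc (f x) _ s ⟩
    f x + (Σℚ f xs + s)     ≤⟨ +-mono-≤ (f≤M (here refl)) (Σℚ-≤-slack xs (f≤M ∘ there) z∈ fz) ⟩
    M + length xs · M       ∎
    where open ≤-Reasoning

module _ {B : Set} {E : Pred B 0ℓ} (E? : Decidable₁ E) where

  prob-++ : ∀ d e → prob E? (d ++ e) ≡ prob E? d + prob E? e
  prob-++ []            e = sym (+-identityˡ _)
  prob-++ ((p , b) ∷ d) e with does (E? b)
  ... | true  = trans (cong (p +_) (prob-++ d e)) (sym (+-assoc p _ _))
  ... | false = prob-++ d e

  prob-scale : ∀ p d → prob E? (map (λ (q , b) → (p * q , b)) d) ≡ p * prob E? d
  prob-scale p []            = sym (*-zeroʳ p)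
  prob-scale p ((q , b) ∷ d) with does (E? b)
  ... | true  = trans (cong (_+_ (p * q)) (prob-scale p d)) (sym (*-distribˡ-+ p q _))
  ... | false = prob-scale p d

  prob-weighted : ∀ {A : Set} w (f : A → Dist B) ys →
    prob E? (map (λ a → (w , a)) ys >>= f) ≡ w * Σℚ (prob E? ∘ f) ys
  prob-weighted w f []       = sym (*-zeroʳ w)
  prob-weighted w f (y ∷ ys) =
    trans (prob-++ (map (λ (q , b) → (w * q , b)) (f y)) _)
    (trans (cong₂ _+_ (prob-scale w (f y)) (prob-weighted w f ys)) (sym (*-distribˡ-+ w _ _)))

  prob-uniform-≤ : ∀ {A : Set} (f : A → Dist B) {c} ys → c ≥0 →
    Σℚ (prob E? ∘ f) ys ≤ length ys · c → prob E? (uniform ys >>= f) ≤ c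
  -- There is nothing to choose from, and the dummy distribution gives every event probability 0.
  prob-uniform-≤ f []           c≥0 avg = c≥0
  prob-uniform-≤ f {c} ys@(_ ∷ ys′) c≥0 avg = begin
    prob E? (uniform ys >>= f)           ≡⟨ prob-weighted w f ys ⟩
    w * Σℚ (prob E? ∘ f) ys              ≤⟨ *-monoˡ (1/suc≥0 (length ys′)) avg ⟩
    w * (length ys · c)                  ≡⟨ *-comm w _ ⟩
    (length ys · c) * w                  ≡⟨ ·-assoc-* (length ys) c w ⟩
    length ys · (c * w)                  ≡⟨ cong (length ys ·_) (*-comm c w) ⟩
    length ys · (w * c)                  ≡⟨ ·-assoc-* (length ys) w c ⟨
    (length ys · w) * c                  ≡⟨ cong (_* c) (suc·1/suc (length ys′)) ⟩
    1ℚ * c                               ≡⟨ *-identityˡ c ⟩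
    c                                    ∎
    where
    open ≤-Reasoning
    w = ℤ.+ 1 / length ys

  prob-return-≤ : ∀ {b c} → c ≥0 → (E b → 1ℚ ≤ c) → prob (Maybe.dec E?) (return (just b)) ≤ c
  prob-return-≤ {b} c≥0 1≤c with E? b
  ... | yes e = ≤-trans (≤-reflexive (+-identityʳ 1ℚ)) (1≤c e)
  ... | no  _ = c≥0

-- Supermartingales of product form

Πℚ : (ℕ → ℚ) → ℕ → ℕ → ℚ
Πℚ f a zero    = 1ℚ
Πℚ f a (suc w) = f a * Πℚ f (suc a) w

Πℚ-≥0 : ∀ {f} → (∀ k → f k ≥0) → ∀ a w → Πℚ f a w ≥0
Πℚ-≥0 f≥0 a zero    = 1≥0
Πℚ-≥0 f≥0 a (suc w) = *≥0 (f≥0 a) (Πℚ-≥0 f≥0 (suc a) w)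

Πℚ-mono : ∀ {f g} → (∀ k → f k ≥0) → (∀ k → g k ≥0) → ∀ a w →
          (∀ k → a ℕ.≤ k → k ℕ.< a ℕ.+ w → f k ≤ g k) → Πℚ f a w ≤ Πℚ g a w
Πℚ-mono f≥0 g≥0 a zero    f≤g = ≤-refl
Πℚ-mono f≥0 g≥0 a (suc w) f≤g = *-mono (g≥0 a) (Πℚ-≥0 f≥0 (suc a) w)
  (f≤g a ℕₚ.≤-refl (ℕₚ.m<m+n a ℕ.z<s))
  (Πℚ-mono f≥0 g≥0 (suc a) w λ k a<k k< → f≤g k (ℕₚ.<⇒≤ a<k) (subst (k ℕ.<_) (sym (ℕₚ.+-suc a w)) k<))

Πℚ-const : ∀ c a w → Πℚ (λ _ → c) a w ≡ c ^ w
Πℚ-const c a zero    = refl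
Πℚ-const c a (suc w) = cong (c *_) (Πℚ-const c (suc a) w)

Πℚ-≡1 : ∀ {f} a w → (∀ k → a ℕ.≤ k → k ℕ.< a ℕ.+ w → f k ≡ 1ℚ) → Πℚ f a w ≡ 1ℚ
Πℚ-≡1 a zero    f≡1 = refl
Πℚ-≡1 a (suc w) f≡1 = cong₂ _*_ (f≡1 a ℕₚ.≤-refl (ℕₚ.m<m+n a ℕ.z<s))
  (Πℚ-≡1 (suc a) w λ k a<k k< → f≡1 k (ℕₚ.<⇒≤ a<k) (subst (k ℕ.<_) (sym (ℕₚ.+-suc a w)) k<))

+-cancelʳ : ∀ r {p q} → p + r ≤ q + r → p ≤ q
+-cancelʳ r {p} {q} p+r≤q+r = subst₂ _≤_ (x+r-r≡x p) (x+r-r≡x q) (+-monoˡ-≤ (- r) p+r≤q+r)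
  where
  open +-*-Solver
  x+r-r≡x : ∀ x → x + r - r ≡ x
  x+r-r≡x x = solve 2 (λ x r → x :+ r :- r := x) refl x r

-- A random step from f to g y, y uniform in ys, that can spoil only the factor
-- k₀ and improves that factor enough for y = z does not increase the product
-- on average.
module _ {Y : Set} {ys : List Y} {z : Y} (z∈ys : z ∈ ys) {d : ℕ} (∣ys∣≤d : length ys ℕ.≤ d)
         {f : ℕ → ℚ} {g : Y → ℕ → ℚ}
         (f≥0 : ∀ k → f k ≥0) (f≤1 : ∀ k → f k ≤ 1ℚ)
         (g≥0 : ∀ y k → g y k ≥0) (g≤1 : ∀ y k → g y k ≤ 1ℚ)
         {k₀ : ℕ}
         (others : ∀ {y k} → y ∈ ys → k ≢ k₀ → g y k ≤ f k)
         (gain : g z k₀ + d · (1ℚ - f k₀) ≤ 1ℚ)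
  where

  private
    -- The witness `M` is the product of `f` over the window with the factor at `k₀`, if it occurs,
    -- omitted. No step exceeds `M`, and the step to `z` stays below it by a margin of `d` times the
    -- excess of `M` over the product of `f`.
    envelope : ∀ a w → ∃[ M ] Πℚ f a w ≤ M × (∀ {y} → y ∈ ys → Πℚ (g y) a w ≤ M) ×
                              Πℚ (g z) a w + d · (M - Πℚ f a w) ≤ M
    envelope a zero = 1ℚ , ≤-refl , (λ _ → ≤-refl) , ≤-reflexive (trans (cong (1ℚ +_) (·-zero d)) (+-identityʳ 1ℚ))
    envelope a (suc w) with a ℕ.≟ k₀
    ... | yes refl = P , *≤P (f≤1 a) ≤-refl P≥0 , (λ y∈ → *≤P (g≤1 _ a) (tail y∈) (Πℚ-≥0 (g≥0 _) (suc a) w)) , slack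
      where
      P = Πℚ f (suc a) w
      P≥0 : P ≥0
      P≥0 = Πℚ-≥0 f≥0 (suc a) w
      *≤P : ∀ {p q} → p ≤ 1ℚ → q ≤ P → q ≥0 → p * q ≤ P
      *≤P p≤1 q≤P q≥0 = subst (_ ≤_) (*-identityˡ P) (*-mono 1≥0 q≥0 p≤1 q≤P)
      tail : ∀ {y} → y ∈ ys → Πℚ (g y) (suc a) w ≤ P
      tail y∈ = Πℚ-mono (g≥0 _) f≥0 (suc a) w λ k a<k _ → others y∈ (ℕₚ.<⇒≢ a<k ∘ sym)
      open +-*-Solver
      slack : g z a * Πℚ (g z) (suc a) w + d · (P - f a * P) ≤ P
      slack = begin
        g z a * Πℚ (g z) (suc a) w + d · (P - f a * P)
          ≤⟨ +-monoˡ-≤ _ (*-monoˡ (g≥0 z a) (tail z∈ys)) ⟩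
        g z a * P + d · (P - f a * P)
          ≡⟨ cong (λ x → g z a * P + d · x) (solve 2 (λ p q → p :- q :* p := (con 1ℚ :- q) :* p) refl P (f a)) ⟩
        g z a * P + d · ((1ℚ - f a) * P)
          ≡⟨ cong (_+_ (g z a * P)) (·-assoc-* d (1ℚ - f a) P) ⟨
        g z a * P + d · (1ℚ - f a) * P
          ≡⟨ *-distribʳ-+ P (g z a) _ ⟨
        (g z a + d · (1ℚ - f a)) * P
          ≤⟨ *-monoʳ P≥0 gain ⟩
        1ℚ * P
          ≡⟨ *-identityˡ P ⟩
        P ∎
        where open ≤-Reasoning
    ... | no a≢k₀ with envelope (suc a) w
    ... | M , f≤M , g≤M , slack =
      f a * M , *-monoˡ (f≥0 a) f≤M ,
      (λ y∈ → *-mono (f≥0 a) (Πℚ-≥0 (g≥0 _) (suc a) w) (others y∈ a≢k₀) (g≤M y∈)) , slack′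
      where
      open +-*-Solver
      P = Πℚ f (suc a) w
      Q = Πℚ (g z) (suc a) w
      slack′ : g z a * Q + d · (f a * M - f a * P) ≤ f a * M
      slack′ = begin
        g z a * Q + d · (f a * M - f a * P)
          ≤⟨ +-monoˡ-≤ _ (*-monoʳ (Πℚ-≥0 (g≥0 z) (suc a) w) (others z∈ys a≢k₀)) ⟩
        f a * Q + d · (f a * M - f a * P)
          ≡⟨ cong (λ x → f a * Q + d · x) (solve 3 (λ q m p → q :* m :- q :* p := (m :- p) :* q) refl (f a) M P) ⟩
        f a * Q + d · ((M - P) * f a)
          ≡⟨ cong (_+_ (f a * Q)) (·-assoc-* d (M - P) (f a)) ⟨
        f a * Q + d · (M - P) * f a
          ≡⟨ solve 3 (λ q x s → q :* x :+ s :* q := q :* (x :+ s)) refl (f a) Q (d · (M - P)) ⟩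
        f a * (Q + d · (M - P))
          ≤⟨ *-monoˡ (f≥0 a) slack ⟩
        f a * M ∎
        where open ≤-Reasoning

  -- Bounding every step by `M` overshoots the target by `length ys` times `M - P`. Since
  -- `length ys ≤ d`, the margin of the single step to `z` pays for this.
  Πℚ-supermartingale : ∀ a w → Σℚ (λ y → Πℚ (g y) a w) ys ≤ length ys · Πℚ f a w
  Πℚ-supermartingale a w with envelope a w
  ... | M , f≤M , g≤M , slack = +-cancelʳ (d · (M - P)) (begin
    Σℚ (λ y → Πℚ (g y) a w) ys + d · (M - P)   ≤⟨ Σℚ-≤-slack ys g≤M z∈ys slack ⟩
    length ys · M                              ≡⟨ cong (length ys ·_) (solve 2 (λ m p → m := p :+ (m :- p)) refl M P) ⟩
    length ys · (P + (M - P))                  ≡⟨ ·-distrib-+ (length ys) P (M - P) ⟩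
    length ys · P + length ys · (M - P)        ≤⟨ +-monoʳ-≤ (length ys · P) (·-mono (-≥0 f≤M) ∣ys∣≤d) ⟩
    length ys · P + d · (M - P)                ∎)
    where
    open +-*-Solver
    open ≤-Reasoning
    P = Πℚ f a w

-- Paths and loop erasure

-- Descent to ever smaller witnesses; `b` bounds the current witness and decreases structurally.
findLeast : ∀ {P : Pred ℕ 0ℓ} → Decidable₁ P → ∀ b k → k ℕ.≤ b → P k → ∃[ d ] d ℕ.≤ k × IsLeast P d
findLeast {P} P? b k k≤b pk with ℕₚ.anyUpTo? P? k
... | no ∄j = k , ℕₚ.≤-refl , pk , λ j pj → ℕₚ.≮⇒≥ λ j<k → ∄j (j , j<k , pj)
findLeast P? zero    k ℕ.z≤n pk | yes (_ , () , _)
findLeast P? (suc b) k k≤b   pk | yes (j , j<k , pj)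
  with d , d≤j , least ← findLeast P? b j (ℕₚ.≤-pred (ℕₚ.≤-trans j<k k≤b)) pj
  = d , ℕₚ.≤-trans d≤j (ℕₚ.<⇒≤ j<k) , least

module _ {A : Set} where

  unique-⊆⇒length-≤ : ∀ {xs ys : List A} → Unique xs → (∀ {x} → x ∈ xs → x ∈ ys) → length xs ℕ.≤ length ys
  unique-⊆⇒length-≤ [] xs⊆ys = ℕ.z≤n
  unique-⊆⇒length-≤ {x ∷ xs} (x∉xs ∷ !xs) xs⊆ys with ∈-∃++ (xs⊆ys (here refl))
  ... | ps , qs , refl = begin
    suc (length xs)                 ≤⟨ ℕ.s≤s (unique-⊆⇒length-≤ !xs xs⊆ps++qs) ⟩
    suc (length (ps ++ qs))         ≡⟨ cong suc (length-++ ps) ⟩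
    suc (length ps ℕ.+ length qs)   ≡⟨ ℕₚ.+-suc (length ps) (length qs) ⟨
    length ps ℕ.+ suc (length qs)   ≡⟨ length-++ ps ⟨
    length (ps ++ x ∷ qs)           ∎
    where
    open ℕₚ.≤-Reasoning
    xs⊆ps++qs : ∀ {z} → z ∈ xs → z ∈ ps ++ qs
    xs⊆ps++qs z∈xs with ∈-++⁻ ps (xs⊆ys (there z∈xs))
    ... | inj₁ z∈ps          = ∈-++⁺ˡ z∈ps
    ... | inj₂ (here refl)   = contradiction refl (All.lookup x∉xs z∈xs)
    ... | inj₂ (there z∈qs)  = ∈-++⁺ʳ ps z∈qs

  unique-suffix : ∀ (ps : List A) {qs} → Unique (ps ++ qs) → Unique qs
  unique-suffix []       !qs       = !qs
  unique-suffix (_ ∷ ps) (_ ∷ !qs) = unique-suffix ps !qs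

  unique-∷ : ∀ {x : A} {xs} → x ∉ xs → Unique xs → Unique (x ∷ xs)
  unique-∷ x∉xs !xs = All.tabulate (λ z∈xs x≡z → x∉xs (subst (_∈ _) (sym x≡z) z∈xs)) ∷ !xs

  unique-head : ∀ {x : A} {xs} → Unique (x ∷ xs) → x ∉ xs
  unique-head (x≢xs ∷ _) x∈xs = All.lookup x≢xs x∈xs refl

  pathEdges : List A → List (A × A)
  pathEdges π = zip π (drop 1 π)

  -- The edges of a path that is stored with its last vertex first
  revEdges : List A → List (A × A)
  revEdges []          = []
  revEdges (_ ∷ [])    = []
  revEdges (b ∷ a ∷ p) = (a , b) ∷ revEdges (a ∷ p)

  pathEdges-∷ʳ : ∀ p (a b : A) → pathEdges (p ∷ʳ a ∷ʳ b) ≡ pathEdges (p ∷ʳ a) ∷ʳ (a , b)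
  pathEdges-∷ʳ []          a b = refl
  pathEdges-∷ʳ (_ ∷ [])    a b = refl
  pathEdges-∷ʳ (x ∷ y ∷ p) a b = cong ((x , y) ∷_) (pathEdges-∷ʳ (y ∷ p) a b)

  pathEdges-reverse : ∀ p → pathEdges (reverse p) ≡ reverse (revEdges p)
  pathEdges-reverse []          = refl
  pathEdges-reverse (_ ∷ [])    = refl
  pathEdges-reverse (b ∷ a ∷ p) = begin
    pathEdges (reverse (b ∷ a ∷ p))               ≡⟨ cong pathEdges (unfold-reverse b (a ∷ p)) ⟩
    pathEdges (reverse (a ∷ p) ∷ʳ b)              ≡⟨ cong (λ q → pathEdges (q ∷ʳ b)) (unfold-reverse a p) ⟩
    pathEdges (reverse p ∷ʳ a ∷ʳ b)               ≡⟨ pathEdges-∷ʳ (reverse p) a b ⟩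
    pathEdges (reverse p ∷ʳ a) ∷ʳ (a , b)         ≡⟨ cong (λ q → pathEdges q ∷ʳ (a , b)) (unfold-reverse a p) ⟨
    pathEdges (reverse (a ∷ p)) ∷ʳ (a , b)        ≡⟨ cong (_∷ʳ (a , b)) (pathEdges-reverse (a ∷ p)) ⟩
    reverse (revEdges (a ∷ p)) ∷ʳ (a , b)         ≡⟨ unfold-reverse (a , b) (revEdges (a ∷ p)) ⟨
    reverse (revEdges (b ∷ a ∷ p))                ∎
    where open ≡-Reasoning

  revEdges-∷⁺ : ∀ x (p : List A) {e} → e ∈ revEdges p → e ∈ revEdges (x ∷ p)
  revEdges-∷⁺ x (_ ∷ _) = there

  revEdges-++⁺ : ∀ (ps : List A) {qs e} → e ∈ revEdges qs → e ∈ revEdges (ps ++ qs)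
  revEdges-++⁺ []       e∈ = e∈
  revEdges-++⁺ (x ∷ ps) e∈ = revEdges-∷⁺ x (ps ++ _) (revEdges-++⁺ ps e∈)

  data EndsWith (x : A) : List A → Set where
    [-] : EndsWith x (x ∷ [])
    _∷_ : ∀ y {p} → EndsWith x p → EndsWith x (y ∷ p)

  endsWith⇒∈ : ∀ {x p} → EndsWith x p → x ∈ p
  endsWith⇒∈ [-]     = here refl
  endsWith⇒∈ (_ ∷ e) = there (endsWith⇒∈ e)

  endsWith-suffix : ∀ ps {x y qs} → EndsWith x (ps ++ y ∷ qs) → EndsWith x (y ∷ qs)
  endsWith-suffix []           e       = e
  endsWith-suffix (_ ∷ [])     (_ ∷ e) = e
  endsWith-suffix (_ ∷ p ∷ ps) (_ ∷ e) = endsWith-suffix (p ∷ ps) e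

module Erasure (G : FiniteGraph) where
  open FiniteGraph G
  open Wilson G hiding (IsOrdering; ℙWilson≤; FarFromFirstPath; farFromFirstPath?)
  open DecMembership _≟_ using (_∈?_)

  extend-∉ : ∀ {π x} → x ∉ π → extend π x ≡ x ∷ π
  extend-∉ {π} {x} x∉π with x ∈? π
  ... | yes x∈π = contradiction x∈π x∉π
  ... | no  _   = refl

  extend-∈ : ∀ {π x} → x ∈ π → ∃₂ λ ps qs → π ≡ ps ++ x ∷ qs × extend π x ≡ x ∷ qs
  extend-∈ {π} {x} x∈π with x ∈? π
  ... | no x∉π = contradiction x∈π x∉π
  ... | yes _  = suffix π x∈π
    where
    suffix : ∀ π → x ∈ π → ∃₂ λ ps qs → π ≡ ps ++ x ∷ qs × dropWhile (λ y → ¬? (y ≟ x)) π ≡ x ∷ qs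
    suffix (y ∷ π) x∈ with y ≟ x
    suffix (y ∷ π) x∈          | yes refl = [] , π , refl , refl
    suffix (y ∷ π) (here refl) | no y≢x   = contradiction refl y≢x
    suffix (y ∷ π) (there x∈)  | no _ with ps , qs , refl , eq ← suffix π x∈ = y ∷ ps , qs , refl , eq

  extend-cases : ∀ π x → x ∉ π × extend π x ≡ x ∷ π ⊎
                 x ∈ π × (∃₂ λ ps qs → π ≡ ps ++ x ∷ qs × extend π x ≡ x ∷ qs)
  extend-cases π x = decide (x ∈? π)
    where
    decide : Dec (x ∈ π) → _
    decide (yes x∈π) = inj₂ (x∈π , extend-∈ x∈π)
    decide (no x∉π)  = inj₁ (x∉π , extend-∉ x∉π)

  foldl-extend-∷ : ∀ γ {π} y → foldl extend [] (reverse γ) ≡ π → foldl extend [] (reverse (y ∷ γ)) ≡ extend π y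
  foldl-extend-∷ γ y refl = trans (cong (foldl extend []) (unfold-reverse y γ)) (foldl-∷ʳ extend [] y (reverse γ))

  -- Invariant of the loop-erased trajectory of a walk started at `x` while it avoids the tree with
  -- vertices `F`. As the last vertex is stored first, the start `x` is the final entry.
  record Path (F : List V) (x : V) (π : List V) : Set where
    field
      distinct : Unique π
      fresh    : ∀ {u} → u ∈ π → u ∉ F
      adjacent : ∀ {u w} → (u , w) ∈ revEdges π → u ~ w
      from     : EndsWith x π

  open Path

  path-[-] : ∀ {F x} → x ∉ F → Path F x (x ∷ [])
  path-[-] x∉F = record
    { distinct = unique-∷ (λ ()) []
    ; fresh    = λ { (here refl) → x∉F }
    ; adjacent = λ ()
    ; from     = [-]
    }

  -- Erasing a loop leaves a suffix of the stored list, and all clauses of the invariant pass to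
  -- nonempty suffixes.
  path-extend : ∀ {F x y p y′} → Path F x (y ∷ p) → y ~ y′ → y′ ∉ F →
                ∃[ p′ ] extend (y ∷ p) y′ ≡ y′ ∷ p′ × Path F x (y′ ∷ p′)
  path-extend {F} {x} {y} {p} {y′} path y~y′ y′∉F with extend-cases (y ∷ p) y′
  ... | inj₁ (y′∉π , eq) = y ∷ p , eq , record
    { distinct = unique-∷ y′∉π (distinct path)
    ; fresh    = λ { (here refl) → y′∉F ; (there u∈) → fresh path u∈ }
    ; adjacent = λ { (here refl) → y~y′ ; (there e∈) → adjacent path e∈ }
    ; from     = y′ ∷ from path
    }
  ... | inj₂ (_ , ps , qs , π≡ , eq) = qs , eq , record
    { distinct = unique-suffix ps (subst Unique π≡ (distinct path))
    ; fresh    = λ u∈ → fresh path (subst (λ π → _ ∈ π) (sym π≡) (∈-++⁺ʳ ps u∈))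
    ; adjacent = λ e∈ → adjacent path (subst (λ π → _ ∈ revEdges π) (sym π≡) (revEdges-++⁺ ps e∈))
    ; from     = endsWith-suffix ps (subst (EndsWith x) π≡ (from path))
    }

  -- A walk of length `k` bounds the distance to `u`, which bounds the distance to the first path.
  -- Both minima exist because the predicates are decidable and have a witness.
  walk⇒¬far : ∀ t {v u l k} → u ∈ firstPath t → Walk (_~ᵀ_ t) k v u → k ℕ.< l → ¬ FarFromFirstPath G v l t
  walk⇒¬far t {v} {u} {l} {k} u∈L walk k<l far
    with d , d≤k , isDist ← findLeast (λ j → walk? (_~ᵀ?_ {t}) j v u) k k ℕₚ.≤-refl walk
    with e , e≤d , isDistTo ← findLeast
           (λ j → map′ find (λ (_ , u∈ , δ) → lose u∈ δ) (any? (λ u → isDistance? t v u j) (firstPath t)))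
           d d ℕₚ.≤-refl (u , u∈L , isDist)
    = ℕₚ.<⇒≱ k<l (ℕₚ.≤-trans (far e isDistTo) (ℕₚ.≤-trans e≤d d≤k))

-- Good rings

-- By orbit, next runs cyclically through all vertices of a level; by windowSize there
-- are at most suc n′ of them.
record Rings (G : FiniteGraph) : Set₁ where
  open FiniteGraph G
  field
    n′         : ℕ
    label      : V → ℕ
    next       : V → V
    ~-label    : ∀ {u w} → u ~ w → label w ℕ.≤ suc (label u)
    ~-next     : ∀ u → u ~ next u
    label-next : ∀ u → label (next u) ≡ label u
    orbit      : ∀ (P : Pred V 0ℓ) → (∀ {u} → P u → P (next u)) → ∀ {u w} → label u ≡ label w → P u → P w
    windowSize : ∀ a w {q} → Unique q → (∀ {u} → u ∈ q → a ℕ.≤ label u × label u ℕ.< a ℕ.+ w) →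
                 length q ℕ.≤ w ℕ.* suc n′

module Blocking (G : FiniteGraph) (rings : Rings G) where

  open FiniteGraph G
  open Rings rings
  open Wilson G hiding (IsOrdering; ℙWilson≤; FarFromFirstPath; farFromFirstPath?)
  open Erasure G
  open DecMembership _≟_ using (_∈?_)

  private
    n = suc n′
    -- `d` reduces to `suc d′`, the form of denominator used for unit fractions.
    d′ = n′ ℕ.+ 2 ℕ.* n
    d = 3 ℕ.* n

  ε : ℚ
  ε = ℤ.+ 1 / d

  ε≥0 : ε ≥0
  ε≥0 = 1/suc≥0 d′

  ε≤1 : ε ≤ 1ℚ
  ε≤1 = 1/suc≤1 d′

  -- All neighbours lie in three consecutive levels. Truncated subtraction starts the window at 0
  -- when `label v` is 0.
  degree-≤ : ∀ v → length (neighbours v) ℕ.≤ d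
  degree-≤ v = windowSize (label v ℕ.∸ 1) 3 (Unique.filter⁺ (v ~?_) unique) λ u∈ →
    let v~u = proj₂ (∈-filter⁻ (v ~?_) {xs = vertices} u∈) in
    ℕₚ.m≤n+o⇒m∸n≤o (label v) 1 (~-label (~-sym v~u)) , above (label v) (~-label v~u)
    where
    above : ∀ k {j} → j ℕ.≤ suc k → j ℕ.< k ℕ.∸ 1 ℕ.+ 3
    above zero    j≤1 = s≤s (ℕₚ.≤-trans j≤1 (ℕₚ.n≤1+n 1))
    above (suc k) j≤k = ℕₚ.≤-trans (s≤s j≤k) (ℕₚ.≤-reflexive (ℕₚ.+-comm 3 k))

  -- Edges are directed towards the first path. A vertex without an outgoing edge imposes no
  -- condition, so the predicate applies to unfinished trees; a level without vertices is vacuously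
  -- good.
  Good : ℕ → List (V × V) → Set
  Good k es = All (λ (u , w) → label u ≡ k → w ≡ next u) es

  good? : ∀ k es → Dec (Good k es)
  good? k = All.all? λ (u , w) → (label u ℕ.≟ k) →-dec (w ≟ next u)

  outside : ℕ → List V → List V
  outside k D = filter (λ u → (label u ℕ.≟ k) ×-dec ¬? (u ∈? D)) vertices

  module _ {k : ℕ} where

    ∈-outside⁺ : ∀ {D u} → label u ≡ k → u ∉ D → u ∈ outside k D
    ∈-outside⁺ ℓ u∉D = ∈-filter⁺ _ (complete _) (ℓ , u∉D)

    ∈-outside⁻ : ∀ {D u} → u ∈ outside k D → label u ≡ k × u ∉ D
    ∈-outside⁻ {D} u∈ = proj₂ (∈-filter⁻ (λ u → (label u ℕ.≟ k) ×-dec ¬? (u ∈? D)) {xs = vertices} u∈)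

    unique-outside : ∀ D → Unique (outside k D)
    unique-outside D = Unique.filter⁺ (λ u → (label u ℕ.≟ k) ×-dec ¬? (u ∈? D)) unique

    module _ {D D′ : List V} (D⊆D′ : ∀ {u : V} → label u ≡ k → u ∈ D → u ∈ D′) where

      outside-⊆ : ∀ {u} → u ∈ outside k D′ → u ∈ outside k D
      outside-⊆ u∈ with ℓ , u∉D′ ← ∈-outside⁻ u∈ = ∈-outside⁺ ℓ (u∉D′ ∘ D⊆D′ ℓ)

      outside-mono : length (outside k D′) ℕ.≤ length (outside k D)
      outside-mono = unique-⊆⇒length-≤ (unique-outside D′) outside-⊆

      outside-strict : ∀ {y} → label y ≡ k → y ∉ D → y ∈ D′ →
                       suc (length (outside k D′)) ℕ.≤ length (outside k D)
      outside-strict ℓ y∉D y∈D′ = unique-⊆⇒length-≤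
        (unique-∷ (λ y∈ → proj₂ (∈-outside⁻ y∈) y∈D′) (unique-outside D′))
        λ { (here refl) → ∈-outside⁺ ℓ y∉D ; (there u∈) → outside-⊆ u∈ }

  outside-≤ : ∀ k D → length (outside k D) ℕ.≤ n
  outside-≤ k D = subst (length (outside k D) ℕ.≤_) (ℕₚ.*-identityˡ n)
    (windowSize k 1 (unique-outside D) λ u∈ →
      let ℓ = proj₁ (∈-outside⁻ {D = D} u∈) in
      ℕₚ.≤-reflexive (sym ℓ) , ℕₚ.≤-reflexive (trans (cong suc ℓ) (ℕₚ.+-comm 1 k)))

  -- The factor attached to a ring

  value : ∀ {P : Set} → Dec P → ℕ → ℚ
  value (yes _) c = 1ℚ - ε ^ c
  value (no  _) c = 1ℚ

  -- Bounds the conditional probability that ring k is not good in the end, when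
  -- es are the edges so far and the vertices outside D have no outgoing edge.
  φ : ℕ → List (V × V) → List V → ℚ
  φ k es D = value (good? k es) (length (outside k D))

  1-ε^≤1 : ∀ c → 1ℚ - ε ^ c ≤ 1ℚ
  1-ε^≤1 c = subst (1ℚ - ε ^ c ≤_) (+-identityʳ 1ℚ) (+-monoʳ-≤ 1ℚ (neg-antimono-≤ (^-≥0 c ε≥0)))

  1-ε^≥0 : ∀ c → (1ℚ - ε ^ c) ≥0
  1-ε^≥0 c = -≥0 (^-≤1 c ε≥0 ε≤1)

  1-ε^-mono : ∀ {b c} → b ℕ.≤ c → 1ℚ - ε ^ b ≤ 1ℚ - ε ^ c
  1-ε^-mono b≤c = +-monoʳ-≤ 1ℚ (neg-antimono-≤ (^-antimono ε≥0 ε≤1 b≤c))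

  value≥0 : ∀ {P} (P? : Dec P) c → value P? c ≥0
  value≥0 (yes _) c = 1-ε^≥0 c
  value≥0 (no  _) c = 1≥0

  value≤1 : ∀ {P} (P? : Dec P) c → value P? c ≤ 1ℚ
  value≤1 (yes _) c = 1-ε^≤1 c
  value≤1 (no  _) c = ≤-refl

  φ≥0 : ∀ k es D → φ k es D ≥0
  φ≥0 k es D = value≥0 (good? k es) _

  φ≤1 : ∀ k es D → φ k es D ≤ 1ℚ
  φ≤1 k es D = value≤1 (good? k es) _

  φ-bad : ∀ k {es} D → ¬ Good k es → φ k es D ≡ 1ℚ
  φ-bad k {es} D ¬good with good? k es
  ... | yes good = contradiction good ¬good
  ... | no  _    = refl

  φ-initial : ∀ k D → φ k [] D ≤ 1ℚ - ε ^ n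
  φ-initial k D = 1-ε^-mono (outside-≤ k D)

  module _ {k : ℕ} {es es′ : List (V × V)} {D D′ : List V} where

    -- A spoilt ring already has the maximal factor 1, so the hypothesis is needed only for a ring
    -- that is still good. There the factor decreases with the number of vertices still to be
    -- treated.
    φ-mono : (Good k es → Good k es′ × (∀ {u} → label u ≡ k → u ∈ D → u ∈ D′)) →
             φ k es′ D′ ≤ φ k es D
    φ-mono h with good? k es
    ... | no  _    = φ≤1 k es′ D′
    ... | yes good with good? k es′ | h good
    ...   | yes _     | _ , D⊆D′  = 1-ε^-mono (outside-mono D⊆D′)
    ...   | no ¬good′ | good′ , _ = contradiction good′ ¬good′

    -- d ε = 1
    φ-gain : ∀ {y} → label y ≡ k →
             (Good k es → Good k es′ × (∀ {u} → label u ≡ k → u ∈ D → u ∈ D′) × y ∉ D × y ∈ D′) →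
             φ k es′ D′ + d · (1ℚ - φ k es D) ≤ 1ℚ
    φ-gain {y} ℓ h with good? k es
    -- For a spoilt ring the compensating term `1 - φ k es D` vanishes.
    ... | no  _    = subst (_≤ 1ℚ) (sym (trans (cong (_+_ (φ k es′ D′)) (·-zero d)) (+-identityʳ _))) (φ≤1 k es′ D′)
    ... | yes good with good? k es′ | h good
    ...   | no ¬good′ | good′ , _ = contradiction good′ ¬good′
    ...   | yes _     | _ , D⊆D′ , y∉D , y∈D′ = begin
      1ℚ - ε ^ c′ + d · (1ℚ - (1ℚ - ε ^ c))
        ≡⟨ cong (λ x → 1ℚ - ε ^ c′ + d · x) (solve 1 (λ x → con 1ℚ :- (con 1ℚ :- x) := x) refl (ε ^ c)) ⟩
      1ℚ - ε ^ c′ + d · (ε ^ c)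
        -- The vertex `y` leaves the set of outside vertices, so `c ≥ c′ + 1`.
        ≤⟨ +-monoʳ-≤ (1ℚ - ε ^ c′) (·-monoʳ d (^-antimono ε≥0 ε≤1 (outside-strict D⊆D′ ℓ y∉D y∈D′))) ⟩
      1ℚ - ε ^ c′ + d · (ε * ε ^ c′)
        ≡⟨ cong (_+_ (1ℚ - ε ^ c′)) (·-assoc-* d ε (ε ^ c′)) ⟨
      1ℚ - ε ^ c′ + d · ε * ε ^ c′
        ≡⟨ cong (λ x → 1ℚ - ε ^ c′ + x * ε ^ c′) (suc·1/suc d′) ⟩
      1ℚ - ε ^ c′ + 1ℚ * ε ^ c′
        ≡⟨ solve 1 (λ x → con 1ℚ :- x :+ con 1ℚ :* x := con 1ℚ) refl (ε ^ c′) ⟩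
      1ℚ ∎
      where
      open ≤-Reasoning
      open +-*-Solver
      c  = length (outside k D)
      c′ = length (outside k D′)

  -- Good rings are left only by moving on to the next vertex, so a path that has
  -- visited a good ring is still in it.
  good-head : ∀ {k u y} p → Good k (revEdges (y ∷ p)) → u ∈ y ∷ p → label u ≡ k → label y ≡ k
  good-head []      _    (here refl) ℓ = ℓ
  good-head (_ ∷ _) _    (here refl) ℓ = ℓ
  good-head {k} {u} {y} (b ∷ p) (step ∷ good) (there u∈) ℓ = begin
    label y         ≡⟨ cong label (step ℓ′) ⟩
    label (next b)  ≡⟨ label-next b ⟩
    label b         ≡⟨ ℓ′ ⟩
    k               ∎
    where
    open ≡-Reasoning
    ℓ′ = good-head p good u∈ ℓ

  -- A vertex in `p` is not the last one of the path, so it has an outgoing path edge, and goodness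
  -- directs that edge to its successor.
  good-next : ∀ {k u y} p → Good k (revEdges (y ∷ p)) → u ∈ p → label u ≡ k → next u ∈ y ∷ p
  good-next (b ∷ p) (step ∷ _)    (here refl) ℓ = here (sym (step ℓ))
  good-next (b ∷ p) (_    ∷ good) (there u∈)  ℓ = there (good-next p good u∈ ℓ)

  -- The vertices of the path in ring `k` are closed under `next`: all but the last by goodness, the
  -- last by hypothesis. Hence they exhaust the ring.
  good-circuit : ∀ {k y p} → Good k (revEdges (y ∷ p)) → label y ≡ k → next y ∈ y ∷ p →
                 ∀ {z} → label z ≡ k → z ∈ y ∷ p
  good-circuit {k} {y} {p} good ℓ next∈ ℓz =
    proj₁ (orbit (λ u → u ∈ y ∷ p × label u ≡ k) closed (trans ℓ (sym ℓz)) (here refl , ℓ))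
    where
    closed : ∀ {u} → u ∈ y ∷ p × label u ≡ k → next u ∈ y ∷ p × label (next u) ≡ k
    closed (here refl , ℓu) = next∈ , trans (label-next _) ℓu
    closed (there u∈  , ℓu) = good-next p good u∈ ℓu , trans (label-next _) ℓu

  -- The algorithm after its first branch

  module FirstBranch (r : V) (L : List V) (r∈L : r ∈ L)
    (meets : ∀ (u : V) → ∃[ z ] z ∈ L × label z ≡ label u)
    where

    T : List (List V) → Tree
    T bs = tree r (L ∷ bs)

    A : List (List V) → List V
    A bs = treeVertices (T bs)

    -- The edges of `L` are left out, since goodness concerns only the vertices outside `L`.
    E : List (List V) → List (V × V)
    E = concatMap pathEdges

    A-∷ʳ : ∀ bs π → A (bs ∷ʳ π) ≡ A bs ++ π
    A-∷ʳ bs π = cong (r ∷_) (trans (sym (concat-++ (L ∷ bs) (π ∷ []))) (cong (concat (L ∷ bs) ++_) (++-identityʳ π)))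

    E-∷ʳ : ∀ bs π → E (bs ∷ʳ π) ≡ E bs ++ pathEdges π
    E-∷ʳ bs π = trans (concatMap-++ pathEdges bs (π ∷ [])) (cong (E bs ++_) (++-identityʳ (pathEdges π)))

    A-∷ʳ⁺ˡ : ∀ {bs π u} → u ∈ A bs → u ∈ A (bs ∷ʳ π)
    A-∷ʳ⁺ˡ {bs} {π} {u} u∈ = subst (u ∈_) (sym (A-∷ʳ bs π)) (∈-++⁺ˡ u∈)

    A-∷ʳ⁺ʳ : ∀ {bs π u} → u ∈ π → u ∈ A (bs ∷ʳ reverse π)
    A-∷ʳ⁺ʳ {bs} {π} {u} u∈ = subst (u ∈_) (sym (A-∷ʳ bs (reverse π))) (∈-++⁺ʳ (A bs) (reverse⁺ u∈))

    A-∷ʳ⁻ : ∀ {bs π u} → u ∈ A (bs ∷ʳ reverse π) → u ∈ A bs ⊎ u ∈ π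
    A-∷ʳ⁻ {bs} {π} {u} u∈ with ∈-++⁻ (A bs) (subst (u ∈_) (A-∷ʳ bs (reverse π)) u∈)
    ... | inj₁ u∈A = inj₁ u∈A
    ... | inj₂ u∈π = inj₂ (reverse⁻ u∈π)

    E-∷ʳ⁻ : ∀ {bs π e} → e ∈ E (bs ∷ʳ reverse π) → e ∈ E bs ⊎ e ∈ revEdges π
    E-∷ʳ⁻ {bs} {π} {e} e∈ with ∈-++⁻ (E bs) (subst (e ∈_) (E-∷ʳ bs (reverse π)) e∈)
    ... | inj₁ e∈E = inj₁ e∈E
    ... | inj₂ e∈π = inj₂ (reverse⁻ (subst (e ∈_) (pathEdges-reverse π) e∈π))

    E-∷ʳ⁺ˡ : ∀ {bs π e} → e ∈ E bs → e ∈ E (bs ∷ʳ π)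
    E-∷ʳ⁺ˡ {bs} {π} {e} e∈ = subst (e ∈_) (sym (E-∷ʳ bs π)) (∈-++⁺ˡ e∈)

    E-∷ʳ⁺ʳ : ∀ {bs π e} → e ∈ revEdges π → e ∈ E (bs ∷ʳ reverse π)
    E-∷ʳ⁺ʳ {bs} {π} {e} e∈ = subst (e ∈_) (sym (E-∷ʳ bs (reverse π)))
      (∈-++⁺ʳ (E bs) (subst (e ∈_) (sym (pathEdges-reverse π)) (reverse⁺ e∈)))

    L⊆A : ∀ {bs u} → u ∈ L → u ∈ A bs
    L⊆A u∈ = there (∈-++⁺ˡ u∈)

    -- The branches after the first one, and the current loop-erased path with its last
    -- vertex first; stateDone omits this last vertex, which has no outgoing edge yet.
    State : Set
    State = List (List V) × List V

    stateEdges : State → List (V × V)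
    stateEdges (bs , π) = E bs ++ revEdges π

    stateDone : State → List V
    stateDone (bs , π) = A bs ++ drop 1 π

    factor : State → ℕ → ℚ
    factor σ k = φ k (stateEdges σ) (stateDone σ)

    factor≥0 : ∀ σ k → factor σ k ≥0
    factor≥0 σ k = φ≥0 k (stateEdges σ) (stateDone σ)

    factor≤1 : ∀ σ k → factor σ k ≤ 1ℚ
    factor≤1 σ k = φ≤1 k (stateEdges σ) (stateDone σ)

    after : State → V → State
    after (bs , π) y with y ∈? A bs
    ... | yes _ = bs ∷ʳ reverse (extend π y) , []
    ... | no  _ = bs , extend π y

    -- A step either gives `y` the outgoing edge to `y′`, by reaching the tree or a new vertex, or
    -- closes a loop and only loses edges. The inclusions recorded here are all that the factors
    -- depend on.
    data Transition (bs : List (List V)) (y : V) (p : List V) (y′ : V) (σ : State) : Set where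
      advance : (∀ {e} → e ∈ stateEdges σ → e ∈ stateEdges (bs , y ∷ p) ⊎ e ≡ (y , y′)) →
                (∀ {u} → u ∈ stateDone (bs , y ∷ p) → u ∈ stateDone σ) → y ∈ stateDone σ →
                Transition bs y p y′ σ
      retreat : y′ ∈ y ∷ p → (∀ {e} → e ∈ stateEdges σ → e ∈ stateEdges (bs , y ∷ p)) →
                (∀ {u} → u ∈ A bs → u ∈ stateDone σ) → Transition bs y p y′ σ

    module _ {bs : List (List V)} {y : V} {p : List V} (fresh : ∀ {u : V} → u ∈ y ∷ p → u ∉ A bs) (!π : Unique (y ∷ p)) where

      transition : ∀ y′ → Transition bs y p y′ (after (bs , y ∷ p) y′)
      transition y′ with y′ ∈? A bs
      ... | yes y′∈A rewrite extend-∉ (λ y′∈π → fresh y′∈π y′∈A) =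
        advance edges⁻
          (λ u∈ → ∈-++⁺ˡ ([ A-∷ʳ⁺ˡ {bs} , (λ u∈p → A-∷ʳ⁺ʳ {bs} {y′ ∷ y ∷ p} (there (there u∈p))) ]′ (∈-++⁻ (A bs) u∈)))
          (∈-++⁺ˡ (A-∷ʳ⁺ʳ {bs} {y′ ∷ y ∷ p} (there (here refl))))
        where
        edges⁻ : ∀ {e} → e ∈ E (bs ∷ʳ reverse (y′ ∷ y ∷ p)) ++ [] → e ∈ E bs ++ revEdges (y ∷ p) ⊎ e ≡ (y , y′)
        edges⁻ e∈ with ∈-++⁻ (E (bs ∷ʳ reverse (y′ ∷ y ∷ p))) e∈
        ... | inj₁ e∈E with E-∷ʳ⁻ {bs} {y′ ∷ y ∷ p} e∈E
        ...   | inj₁ e∈Ebs       = inj₁ (∈-++⁺ˡ e∈Ebs)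
        ...   | inj₂ (here refl) = inj₂ refl
        ...   | inj₂ (there e∈π) = inj₁ (∈-++⁺ʳ (E bs) e∈π)
      ... | no _ with extend-cases (y ∷ p) y′
      ...   | inj₁ (_ , eq) rewrite eq =
        advance edges⁻
          (λ u∈ → [ ∈-++⁺ˡ , (λ u∈p → ∈-++⁺ʳ (A bs) (there u∈p)) ]′ (∈-++⁻ (A bs) u∈))
          (∈-++⁺ʳ (A bs) (here refl))
        where
        edges⁻ : ∀ {e} → e ∈ E bs ++ revEdges (y′ ∷ y ∷ p) → e ∈ E bs ++ revEdges (y ∷ p) ⊎ e ≡ (y , y′)
        edges⁻ e∈ with ∈-++⁻ (E bs) e∈
        ... | inj₁ e∈E         = inj₁ (∈-++⁺ˡ e∈E)
        ... | inj₂ (here refl) = inj₂ refl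
        ... | inj₂ (there e∈π) = inj₁ (∈-++⁺ʳ (E bs) e∈π)
      ...   | inj₂ (y′∈π , ps , qs , eq , eq′) rewrite eq′ =
        retreat y′∈π edges⁻ ∈-++⁺ˡ
        where
        edges⁻ : ∀ {e} → e ∈ E bs ++ revEdges (y′ ∷ qs) → e ∈ E bs ++ revEdges (y ∷ p)
        edges⁻ e∈ with ∈-++⁻ (E bs) e∈
        ... | inj₁ e∈E = ∈-++⁺ˡ e∈E
        ... | inj₂ e∈π = ∈-++⁺ʳ (E bs) (subst (λ π → _ ∈ revEdges π) (sym eq) (revEdges-++⁺ ps e∈π))

      private
        good-path : ∀ {k} → Good k (stateEdges (bs , y ∷ p)) → Good k (revEdges (y ∷ p))
        good-path good = All.tabulate λ e∈ → All.lookup good (∈-++⁺ʳ (E bs) e∈)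

        -- Erasing a loop could raise the count of a good ring `k` by taking away outgoing edges. It
        -- does not: a path that had visited ring `k` would still end in it, whereas its end `y` has
        -- another label.
        others : ∀ {y′ σ k} → Transition bs y p y′ σ → k ≢ label y →
          Good k (stateEdges (bs , y ∷ p)) →
          Good k (stateEdges σ) × (∀ {u} → label u ≡ k → u ∈ stateDone (bs , y ∷ p) → u ∈ stateDone σ)
        others (advance edges⁻ done⁺ _) k≢ good =
          (All.tabulate λ e∈ → [ All.lookup good , (λ { refl ℓ → contradiction (sym ℓ) k≢ }) ]′ (edges⁻ e∈)) ,
          λ _ → done⁺
        others (retreat _ edges⁻ done⁺) k≢ good =
          (All.tabulate λ e∈ → All.lookup good (edges⁻ e∈)) ,
          λ ℓ u∈ → [ done⁺ , (λ u∈p → contradiction (sym (good-head p (good-path good) (there u∈p) ℓ)) k≢) ]′ (∈-++⁻ (A bs) u∈)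

        -- While the ring of `y` is good, moving to `next y` cannot close a loop: the path would
        -- then contain the whole ring and so a vertex of `L`, which it avoids. The step therefore
        -- adds a permitted edge and settles `y`.
        gain : ∀ {σ} → Transition bs y p (next y) σ → Good (label y) (stateEdges (bs , y ∷ p)) →
          Good (label y) (stateEdges σ) ×
          (∀ {u} → label u ≡ label y → u ∈ stateDone (bs , y ∷ p) → u ∈ stateDone σ) ×
          y ∉ stateDone (bs , y ∷ p) × y ∈ stateDone σ
        gain (advance edges⁻ done⁺ y∈) good =
          (All.tabulate λ e∈ → [ All.lookup good , (λ { refl _ → refl }) ]′ (edges⁻ e∈)) ,
          (λ _ → done⁺) ,
          (λ y∈D → [ fresh (here refl) , unique-head !π ]′ (∈-++⁻ (A bs) y∈D)) ,
          y∈
        gain (retreat next∈π _ _) good with z , z∈L , ℓ ← meets y =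
          contradiction (L⊆A {bs} z∈L) (fresh (good-circuit (good-path good) refl next∈π ℓ))

      factor-supermartingale : ∀ a w →
        Σℚ (λ y′ → Πℚ (factor (after (bs , y ∷ p) y′)) a w) (neighbours y)
        ≤ length (neighbours y) · Πℚ (factor (bs , y ∷ p)) a w
      -- The exceptional factor is that of the ring of `y`, and the favourable step goes to
      -- `next y`.
      factor-supermartingale = Πℚ-supermartingale (∈-filter⁺ (y ~?_) (complete _) (~-next y)) (degree-≤ y)
        {factor σ} {factor ∘ after σ}
        (factor≥0 σ) (factor≤1 σ) (factor≥0 ∘ after σ) (factor≤1 ∘ after σ)
        (λ {y′} {k} _ k≢ → φ-mono {k} {stateEdges σ} {stateEdges (after σ y′)} {stateDone σ} {stateDone (after σ y′)}
                                  (others (transition y′) k≢))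
        (φ-gain {label y} {stateEdges σ} {stateEdges (after σ (next y))} {stateDone σ} {stateDone (after σ (next y))}
                refl (gain (transition (next y))))
        where
        σ : State
        σ = bs , y ∷ p

    -- Routes in the tree towards the first path

    data Route (es : List (V × V)) : V → List V → Set where
      stop : ∀ {u} → u ∈ L → Route es u (u ∷ [])
      step : ∀ {u w q} → (u , w) ∈ es → Route es w q → Route es u (u ∷ q)

    route-mono : ∀ {es es′ u q} → (∀ {e} → e ∈ es → e ∈ es′) → Route es u q → Route es′ u q
    route-mono es⊆ (stop u∈L)    = stop u∈L
    route-mono es⊆ (step e∈ rte) = step (es⊆ e∈) (route-mono es⊆ rte)

    route-length : ∀ {bs u q} → Route (E bs) u q → ∃₂ λ k z → z ∈ L × Walk (_~ᵀ_ (T bs)) k u z × suc k ≡ length q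
    route-length {bs} (stop u∈L) = 0 , _ , u∈L , [] , refl
    route-length {bs} (step e∈ rte) with k , z , z∈L , walk , eq ← route-length {bs} rte =
      suc k , z , z∈L , inj₁ (∈-++⁺ʳ (pathEdges L) e∈) ∷ walk , cong suc eq

    -- Induction from the hitting point back along the branch, prolonging the route by one edge at a
    -- time. The vertices stay distinct because the branch avoids `q`.
    branch-routes : ∀ {es} y p {q} → (∀ {e} → e ∈ revEdges (y ∷ p) → e ∈ es) → Unique p →
      Route es y q → Unique q → (∀ {u} → u ∈ p → u ∉ q) →
      ∀ {u} → u ∈ p → ∃[ q′ ] Route es u q′ × Unique q′ × (∀ {x} → x ∈ q′ → x ∈ p ⊎ x ∈ q)
    branch-routes y (b ∷ p) {q} es⊇ !π@(_ ∷ !p) rte !q p∩q (here refl) =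
      b ∷ q , step (es⊇ (here refl)) rte , unique-∷ (p∩q (here refl)) !q ,
      λ { (here refl) → inj₁ (here refl) ; (there x∈) → inj₂ x∈ }
    branch-routes y (b ∷ p) {q} es⊇ !π@(_ ∷ !p) rte !q p∩q (there u∈)
      with q′ , rte′ , !q′ , q′⊆ ← branch-routes b p (es⊇ ∘ there) !p (step (es⊇ (here refl)) rte)
             (unique-∷ (p∩q (here refl)) !q)
             (λ { x∈p (here refl) → unique-head !π x∈p ; x∈p (there x∈q) → p∩q (there x∈p) x∈q }) u∈
      = q′ , rte′ , !q′ , λ x∈ → case-⊎ (q′⊆ x∈)
      where
      case-⊎ : ∀ {x} → x ∈ p ⊎ x ∈ b ∷ q → x ∈ b ∷ p ⊎ x ∈ q
      case-⊎ (inj₁ x∈p)         = inj₁ (there x∈p)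
      case-⊎ (inj₂ (here refl)) = inj₁ (here refl)
      case-⊎ (inj₂ (there x∈q)) = inj₂ x∈q

    record Structured (bs : List (List V)) : Set where
      field
        edges-~ : ∀ {u w} → (u , w) ∈ E bs → u ~ w
        routes  : ∀ {u} → u ∈ A bs → ∃[ q ] Route (E bs) u q × Unique q × (∀ {x} → x ∈ q → x ∈ A bs)

    open Structured

    structured-[] : Structured []
    structured-[] = record
      { edges-~ = λ ()
      ; routes  = λ {u} u∈ → u ∷ [] , stop (u∈L u∈) , unique-∷ (λ ()) [] , λ { (here refl) → u∈ }
      }
      where
      u∈L : ∀ {u} → u ∈ A [] → u ∈ L
      u∈L (here refl) = r∈L
      u∈L (there u∈)  = subst (λ L → _ ∈ L) (++-identityʳ L) u∈

    structured-∷ʳ : ∀ {bs x y p y′} → Structured bs → Path (A bs) x (y ∷ p) → y ~ y′ → y′ ∈ A bs →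
                    Structured (bs ∷ʳ reverse (y′ ∷ y ∷ p))
    structured-∷ʳ {bs} {x} {y} {p} {y′} str path y~y′ y′∈A = record
      { edges-~ = λ e∈ → [ edges-~ str , (λ { (here refl) → y~y′ ; (there e∈) → Path.adjacent path e∈ }) ]′ (E-∷ʳ⁻ {bs} {π} e∈)
      ; routes  = λ u∈ → [ old , new ]′ (A-∷ʳ⁻ {bs} {π} u∈)
      }
      where
      π   = y′ ∷ y ∷ p
      bs′ = bs ∷ʳ reverse π
      old : ∀ {u} → u ∈ A bs → ∃[ q ] Route (E bs′) u q × Unique q × (∀ {x} → x ∈ q → x ∈ A bs′)
      old u∈ with q , rte , !q , q⊆ ← routes str u∈ =
        q , route-mono (E-∷ʳ⁺ˡ {bs}) rte , !q , A-∷ʳ⁺ˡ {bs} ∘ q⊆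
      new : ∀ {u} → u ∈ π → ∃[ q ] Route (E bs′) u q × Unique q × (∀ {x} → x ∈ q → x ∈ A bs′)
      new (here refl) = old y′∈A
      new (there u∈)
        with q , rte , !q , q⊆ ← routes str y′∈A
        with q′ , rte′ , !q′ , q′⊆ ← branch-routes y′ (y ∷ p) (E-∷ʳ⁺ʳ {bs} {π}) (Path.distinct path)
               (route-mono (E-∷ʳ⁺ˡ {bs}) rte) !q (λ u∈π u∈q → Path.fresh path u∈π (q⊆ u∈q)) u∈
        = q′ , rte′ , !q′ , λ x∈ → [ (λ x∈π → A-∷ʳ⁺ʳ {bs} {π} (there x∈π)) , A-∷ʳ⁺ˡ {bs} ∘ q⊆ ]′ (q′⊆ x∈)

    -- An edge changes the label by at most one, so a route would have to enter a good ring before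
    -- passing it, and every edge out of a vertex of a good ring stays in that ring.
    confined : ∀ {es k₁ k₂} → (∀ {u w} → (u , w) ∈ es → u ~ w) → Good k₁ es → Good k₂ es →
               ∀ {u q} → Route es u q → k₂ ℕ.≤ label u × label u ℕ.≤ k₁ →
               ∀ {x} → x ∈ q → k₂ ℕ.≤ label x × label x ℕ.≤ k₁
    confined es~ g₁ g₂ (stop _)   u≤ (here refl) = u≤
    confined es~ g₁ g₂ (step _ _) u≤ (here refl) = u≤
    confined {es} {k₁} {k₂} es~ g₁ g₂ (step {u} {w} e∈ rte) (k₂≤u , u≤k₁) (there x∈) =
      confined es~ g₁ g₂ rte (k₂≤w , w≤k₁) x∈
      where
      stays : ∀ {k} → Good k es → label u ≡ k → label w ≡ k
      stays g ℓ = trans (cong label (All.lookup g e∈ ℓ)) (trans (label-next u) ℓ)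
      w≤k₁ : label w ℕ.≤ k₁
      w≤k₁ with label u ℕ.≟ k₁
      ... | yes ℓ = ℕₚ.≤-reflexive (stays g₁ ℓ)
      ... | no ¬ℓ = ℕₚ.≤-trans (~-label (es~ e∈)) (ℕₚ.≤∧≢⇒< u≤k₁ ¬ℓ)
      k₂≤w : k₂ ℕ.≤ label w
      k₂≤w with k₂ ℕ.≟ label u
      ... | yes ℓ = ℕₚ.≤-reflexive (sym (stays g₂ (sym ℓ)))
      ... | no ¬ℓ = ℕₚ.≤-pred (ℕₚ.≤-trans (ℕₚ.≤∧≢⇒< k₂≤u ¬ℓ) (~-label (~-sym (es~ e∈))))

    -- The potential along the algorithm

    module Potential {P : Pred Tree 0ℓ} (P? : Decidable₁ P) (a₁ a₂ w : ℕ) where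

      -- A union bound: one product for each of two blocks of `w` rings.
      Φ : State → ℚ
      Φ σ = Πℚ (factor σ) a₁ w + Πℚ (factor σ) a₂ w

      Φ≥0 : ∀ σ → Φ σ ≥0
      Φ≥0 σ = +≥0 (Πℚ-≥0 (factor≥0 σ) a₁ w) (Πℚ-≥0 (factor≥0 σ) a₂ w)

      Φ-supermartingale : ∀ {bs x y p} → Path (A bs) x (y ∷ p) →
        Σℚ (λ y′ → Φ (after (bs , y ∷ p) y′)) (neighbours y) ≤ length (neighbours y) · Φ (bs , y ∷ p)
      Φ-supermartingale {bs} {x} {y} {p} path = begin
        Σℚ (λ y′ → Φ (after σ y′)) ys
          ≡⟨ Σℚ-+ (window a₁) (window a₂) ys ⟩
        Σℚ (window a₁) ys + Σℚ (window a₂) ys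
          ≤⟨ +-mono-≤ (factor-supermartingale (Path.fresh path) (Path.distinct path) a₁ w)
                      (factor-supermartingale (Path.fresh path) (Path.distinct path) a₂ w) ⟩
        length ys · Πℚ (factor σ) a₁ w + length ys · Πℚ (factor σ) a₂ w
          ≡⟨ ·-distrib-+ (length ys) _ _ ⟨
        length ys · Φ σ ∎
        where
        open ≤-Reasoning
        ys = neighbours y
        σ : State
        σ = bs , y ∷ p
        window : ℕ → V → ℚ
        window a y′ = Πℚ (factor (after σ y′)) a w

      module _ (final : ∀ {bs : List (List V)} → Structured bs → (∀ (u : V) → u ∈ A bs) → P (T bs) → 1ℚ ≤ Φ (bs , [])) where

        -- Optional stopping, by simultaneous induction over the phases of the algorithm: `Φ` is a
        -- nonnegative supermartingale and is at least 1 whenever the algorithm ends in `P`. Runs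
        -- cut off by the step bound contribute 0.
        grow-≤ : ∀ N bs xs → Structured bs → (∀ u → u ∈ A bs ⊎ u ∈ xs) →
                 prob (Maybe.dec P?) (grow N (T bs) xs) ≤ Φ (bs , [])

        walk-≤ : ∀ N bs xs {x y p γ} → Structured bs → (∀ u → u ∈ A bs ⊎ u ∈ x ∷ xs) →
                 foldl extend [] (reverse γ) ≡ y ∷ p → Path (A bs) x (y ∷ p) →
                 prob (Maybe.dec P?) (walk N (T bs) y γ xs) ≤ Φ (bs , y ∷ p)

        arrive-≤ : ∀ N bs xs {x y p γ} y′ → Structured bs → (∀ u → u ∈ A bs ⊎ u ∈ x ∷ xs) →
                   foldl extend [] (reverse γ) ≡ y ∷ p → Path (A bs) x (y ∷ p) → y ~ y′ →
                   prob (Maybe.dec P?) (arrive N (T bs) y′ (y′ ∷ γ) xs) ≤ Φ (after (bs , y ∷ p) y′)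

        grow-≤ N bs [] str cover =
          prob-return-≤ P? (Φ≥0 (bs , [])) (final {bs} str λ u → [ (λ u∈ → u∈) , (λ ()) ]′ (cover u))
        grow-≤ N bs (x ∷ xs) str cover with x ∈? A bs
        ... | yes x∈A = grow-≤ N bs xs str λ u →
          [ inj₁ , (λ { (here refl) → inj₁ x∈A ; (there u∈) → inj₂ u∈ }) ]′ (cover u)
        -- Starting a walk does not change `Φ`: a path of one vertex has no edges, and its last
        -- vertex does not count as done.
        ... | no x∉A = walk-≤ N bs xs str cover refl (path-[-] x∉A)

        walk-≤ zero    bs xs {y = y} {p} str cover eq path = Φ≥0 (bs , y ∷ p)
        walk-≤ (suc N) bs xs {y = y} {p} {γ} str cover eq path =
          prob-uniform-≤ (Maybe.dec P?) (λ y′ → arrive N (T bs) y′ (y′ ∷ γ) xs) (neighbours y) (Φ≥0 (bs , y ∷ p))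
            (≤-trans (Σℚ-mono (neighbours y) (λ {y′} y′∈ →
                        arrive-≤ N bs xs y′ str cover eq path (proj₂ (∈-filter⁻ (y ~?_) {xs = vertices} y′∈))))
                     (Φ-supermartingale path))

        arrive-≤ N bs xs {x} {y} {p} {γ} y′ str cover eq path y~y′ with y′ ∈? A bs
        ... | yes y′∈A
          rewrite foldl-extend-∷ γ y′ eq | extend-∉ (λ y′∈π → Path.fresh path y′∈π y′∈A) =
          grow-≤ N (bs ∷ʳ reverse (y′ ∷ y ∷ p)) xs (structured-∷ʳ str path y~y′ y′∈A) λ u →
            [ inj₁ ∘ A-∷ʳ⁺ˡ {bs}
            , (λ { (here refl) → inj₁ (A-∷ʳ⁺ʳ {bs} {y′ ∷ y ∷ p} (there (endsWith⇒∈ (Path.from path)))) ; (there u∈) → inj₂ u∈ })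
            ]′ (cover u)
        ... | no y′∉A with p′ , eq′ , path′ ← path-extend path y~y′ y′∉A =
          subst (λ π → prob (Maybe.dec P?) (walk N (T bs) y′ (y′ ∷ γ) xs) ≤ Φ (bs , π)) (sym eq′)
            (walk-≤ N bs xs str cover (trans (foldl-extend-∷ γ y′ eq) eq′) path′)

    -- From good rings to the distance from the first path

    module Far (v : V) (l w : ℕ) (w≤v : w ℕ.≤ label v) (size : 0 ℕ.< w → (2 ℕ.* w ℕ.+ 1) ℕ.* n ℕ.≤ l) where

      open Potential (farFromFirstPath? G v l) (suc (label v)) (label v ℕ.∸ w) w

      goodInWindow? : ∀ a es → Dec (∃[ i ] i ℕ.< w × Good (a ℕ.+ i) es)
      goodInWindow? a es = ℕₚ.anyUpTo? (λ i → good? (a ℕ.+ i) es) w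

      ¬good⇒Πℚ≡1 : ∀ {bs} a → ¬ (∃[ i ] i ℕ.< w × Good (a ℕ.+ i) (E bs ++ [])) → Πℚ (factor (bs , [])) a w ≡ 1ℚ
      ¬good⇒Πℚ≡1 {bs} a ¬good = Πℚ-≡1 a w λ k a≤k k<a+w →
        φ-bad k (stateDone (bs , [])) λ good → ¬good (k ℕ.∸ a , i<w a≤k k<a+w ,
          subst (λ k → Good k (E bs ++ [])) (sym (ℕₚ.m+[n∸m]≡n a≤k)) good)
        where
        i<w : ∀ {k} → a ℕ.≤ k → k ℕ.< a ℕ.+ w → k ℕ.∸ a ℕ.< w
        i<w a≤k k<a+w = ℕₚ.+-cancelˡ-< a _ _ (subst (ℕ._< a ℕ.+ w) (sym (ℕₚ.m+[n∸m]≡n a≤k)) k<a+w)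

      -- The two good rings confine the route from `v` to at most `2 w + 1` levels. Its vertices are
      -- distinct, so they number at most `l`, and its length is one less.
      good⇒¬far : ∀ {bs} → Structured bs → v ∈ A bs →
        ∃[ i ] i ℕ.< w × Good (suc (label v) ℕ.+ i) (E bs ++ []) →
        ∃[ i ] i ℕ.< w × Good (label v ℕ.∸ w ℕ.+ i) (E bs ++ []) →
        ¬ FarFromFirstPath G v l (T bs)
      good⇒¬far {bs} str v∈ (i , i<w , g₁) (j , j<w , g₂)
        with q , rte , !q , _ ← routes str v∈
        with k , z , z∈L , walk , eq ← route-length {bs} rte
        = walk⇒¬far (T bs) z∈L walk (begin
            suc k                              ≡⟨ eq ⟩
            length q                           ≤⟨ windowSize (label v ℕ.∸ w) (2 ℕ.* w ℕ.+ 1) !q inWindow ⟩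
            (2 ℕ.* w ℕ.+ 1) ℕ.* n              ≤⟨ size (ℕₚ.≤-<-trans ℕ.z≤n i<w) ⟩
            l                                  ∎)
        where
        open ℕₚ.≤-Reasoning
        drop-[] : ∀ {k} → Good k (E bs ++ []) → Good k (E bs)
        drop-[] {k} = subst (Good k) (++-identityʳ (E bs))
        lower : label v ℕ.∸ w ℕ.+ j ℕ.≤ label v
        lower = begin
          label v ℕ.∸ w ℕ.+ j   ≤⟨ ℕₚ.+-monoʳ-≤ (label v ℕ.∸ w) (ℕₚ.<⇒≤ j<w) ⟩
          label v ℕ.∸ w ℕ.+ w   ≡⟨ ℕₚ.m∸n+n≡m w≤v ⟩
          label v               ∎
        upper : suc (suc (label v) ℕ.+ i) ℕ.≤ label v ℕ.∸ w ℕ.+ (2 ℕ.* w ℕ.+ 1)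
        upper = begin
          suc (suc (label v) ℕ.+ i)                      ≡⟨ ℕₚ.+-suc (suc (label v)) i ⟨
          suc (label v) ℕ.+ suc i                        ≤⟨ ℕₚ.+-monoʳ-≤ (suc (label v)) i<w ⟩
          suc (label v) ℕ.+ w                            ≡⟨ cong (λ x → suc x ℕ.+ w) (ℕₚ.m∸n+n≡m w≤v) ⟨
          suc (label v ℕ.∸ w ℕ.+ w) ℕ.+ w                ≡⟨ ℕSolver.solve 2 (λ x w → con 1 :+ (x :+ w) :+ w := x :+ (con 2 :* w :+ con 1)) refl (label v ℕ.∸ w) w ⟩
          label v ℕ.∸ w ℕ.+ (2 ℕ.* w ℕ.+ 1)              ∎
          where open ℕSolver using (con; _:+_; _:*_; _:=_)
        inWindow : ∀ {x} → x ∈ q → label v ℕ.∸ w ℕ.≤ label x × label x ℕ.< label v ℕ.∸ w ℕ.+ (2 ℕ.* w ℕ.+ 1)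
        inWindow x∈ with ≤x , x≤ ← confined (edges-~ str) (drop-[] g₁) (drop-[] g₂) rte
                                    (lower , ℕₚ.≤-trans (ℕₚ.n≤1+n _) (ℕₚ.m≤m+n _ i)) x∈
          = ℕₚ.≤-trans (ℕₚ.m≤m+n _ j) ≤x , ℕₚ.≤-trans (s≤s x≤) upper

      -- A block without a good ring has all factors equal to 1. For `w = 0` both blocks are empty
      -- and the bound is trivial, which is why `size` assumes `w` positive.
      far⇒1≤Φ : ∀ {bs} → Structured bs → (∀ u → u ∈ A bs) → FarFromFirstPath G v l (T bs) → 1ℚ ≤ Φ (bs , [])
      far⇒1≤Φ {bs} str complete far
        with goodInWindow? (suc (label v)) (E bs ++ []) | goodInWindow? (label v ℕ.∸ w) (E bs ++ [])
      ... | yes g₁ | yes g₂ = contradiction far (good⇒¬far str (complete v) g₁ g₂)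
      ... | no ¬g₁ | _      = subst₂ _≤_ (+-identityʳ 1ℚ) (cong (_+ Π₂) (sym (¬good⇒Πℚ≡1 {bs} (suc (label v)) ¬g₁)))
                                (+-monoʳ-≤ 1ℚ (Πℚ-≥0 (factor≥0 (bs , [])) (label v ℕ.∸ w) w))
        where Π₂ = Πℚ (factor (bs , [])) (label v ℕ.∸ w) w
      ... | yes _  | no ¬g₂ = subst₂ _≤_ (+-identityˡ 1ℚ) (cong (_+_ Π₁) (sym (¬good⇒Πℚ≡1 {bs} (label v ℕ.∸ w) ¬g₂)))
                                (+-monoˡ-≤ 1ℚ (Πℚ-≥0 (factor≥0 (bs , [])) (suc (label v)) w))
        where Π₁ = Πℚ (factor (bs , [])) (suc (label v)) w

      grow-far-≤ : ∀ N xs → (∀ u → u ∈ A [] ⊎ u ∈ xs) →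
        prob (Maybe.dec (farFromFirstPath? G v l)) (grow N (T []) xs) ≤ (1ℚ - ε ^ n) ^ w + (1ℚ - ε ^ n) ^ w
      grow-far-≤ N xs cover = ≤-trans (grow-≤ far⇒1≤Φ N [] xs structured-[] cover)
        (+-mono-≤ (initial (suc (label v))) (initial (label v ℕ.∸ w)))
        where
        -- No edges outside `L` are present at first, so every ring is good, with at most `n`
        -- vertices left to treat.
        initial : ∀ a → Πℚ (factor ([] , [])) a w ≤ (1ℚ - ε ^ n) ^ w
        initial a = ≤-trans
          (Πℚ-mono (factor≥0 ([] , [])) (λ _ → 1-ε^≥0 n) a w (λ k _ _ → φ-initial k (stateDone ([] , []))))
          (≤-reflexive (Πℚ-const (1ℚ - ε ^ n) a w))

  -- The first walk

  module FirstWalk (r s : V) where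

    Between : ℕ → V → Set
    Between k y = label s ℕ.≤ k × k ℕ.≤ label y ⊎ label y ℕ.≤ k × k ℕ.≤ label s

    closer : ∀ {k b y} → b ~ y → label y ≢ k → Between k y → Between k b
    closer b~y y≢k (inj₁ (s≤k , k≤y)) = inj₁ (s≤k , ℕₚ.≤-pred (ℕₚ.≤-trans (ℕₚ.≤∧≢⇒< k≤y (y≢k ∘ sym)) (~-label b~y)))
    closer b~y y≢k (inj₂ (y≤k , k≤s)) = inj₂ (ℕₚ.≤-trans (~-label (~-sym b~y)) (ℕₚ.≤∧≢⇒< y≤k y≢k) , k≤s)

    -- A discrete intermediate value theorem, followed back from the current end `y` to the start
    -- `s`.
    level-crossing : ∀ {k y p} → EndsWith s (y ∷ p) → (∀ {u w} → (u , w) ∈ revEdges (y ∷ p) → u ~ w) →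
      Between k y → ∃[ z ] z ∈ y ∷ p × label z ≡ k
    level-crossing [-] adj (inj₁ (s≤k , k≤s)) = s , here refl , ℕₚ.≤-antisym s≤k k≤s
    level-crossing [-] adj (inj₂ (s≤k , k≤s)) = s , here refl , ℕₚ.≤-antisym s≤k k≤s
    level-crossing {k} {y} {b ∷ p} (_ ∷ ends) adj k-between with label y ℕ.≟ k
    ... | yes ℓ = y , here refl , ℓ
    ... | no ¬ℓ with z , z∈ , ℓ ← level-crossing ends (adj ∘ there) (closer (adj (here refl)) ¬ℓ k-between) = z , there z∈ , ℓ

    module _ (v : V) (l w : ℕ) (w≤v : w ℕ.≤ label v) (size : 0 ℕ.< w → (2 ℕ.* w ℕ.+ 1) ℕ.* n ℕ.≤ l)
             (s≢r : s ≢ r) (between : ∀ (u : V) → Between (label u) r)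
             (xs : List V) (cover : ∀ (u : V) → u ∈ r ∷ s ∷ xs) where

      private
        bound = (1ℚ - ε ^ n) ^ w + (1ℚ - ε ^ n) ^ w
        far? = Maybe.dec (farFromFirstPath? G v l)

        bound≥0 : bound ≥0
        bound≥0 = +≥0 (^-≥0 w (1-ε^≥0 n)) (^-≥0 w (1-ε^≥0 n))

      -- The bound for the remaining branches is the same for every possible first path, so
      -- averaging over the first walk preserves it.
      first-walk-≤ : ∀ N {y p γ} → foldl extend [] (reverse γ) ≡ y ∷ p → Path (r ∷ []) s (y ∷ p) →
                     prob far? (walk N (tree r []) y γ xs) ≤ bound

      first-arrive-≤ : ∀ N {y p γ} y′ → foldl extend [] (reverse γ) ≡ y ∷ p → Path (r ∷ []) s (y ∷ p) → y ~ y′ →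
                       prob far? (arrive N (tree r []) y′ (y′ ∷ γ) xs) ≤ bound

      first-walk-≤ zero    eq path = bound≥0
      first-walk-≤ (suc N) {y} {p} {γ} eq path =
        prob-uniform-≤ far? (λ y′ → arrive N (tree r []) y′ (y′ ∷ γ) xs) (neighbours y) bound≥0
          (≤-trans (Σℚ-mono (neighbours y) (λ {y′} y′∈ →
                      first-arrive-≤ N y′ eq path (proj₂ (∈-filter⁻ (y ~?_) {xs = vertices} y′∈))))
                   (≤-reflexive (Σℚ-const bound (neighbours y))))

      first-arrive-≤ N {y} {p} {γ} y′ eq path y~y′ with y′ ∈? r ∷ []
      ... | yes (here refl) rewrite foldl-extend-∷ γ y′ eq | extend-∉ (λ y′∈π → Path.fresh path y′∈π (here refl)) =
        FirstBranch.Far.grow-far-≤ r L (reverse⁺ {xs = π} (here refl)) meets v l w w≤v size N xs cover′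
        where
        π = r ∷ y ∷ p
        L = reverse π
        meets : ∀ u → ∃[ z ] z ∈ L × label z ≡ label u
        meets u with z , z∈ , ℓ ← level-crossing {label u} (r ∷ Path.from path)
                       (λ { (here refl) → y~y′ ; (there e∈) → Path.adjacent path e∈ }) (between u)
          = z , reverse⁺ z∈ , ℓ
        cover′ : ∀ u → u ∈ r ∷ concat (L ∷ []) ⊎ u ∈ xs
        cover′ u with cover u
        ... | here refl         = inj₁ (here refl)
        ... | there (here refl) = inj₁ (there (∈-++⁺ˡ (reverse⁺ {xs = π} (there (endsWith⇒∈ (Path.from path))))))
        ... | there (there u∈)  = inj₂ u∈
      ... | no y′∉ with p′ , eq′ , path′ ← path-extend path y~y′ y′∉ =
        first-walk-≤ N (trans (foldl-extend-∷ γ y′ eq) eq′) path′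

      wilson-far-≤ : ℙWilson≤ G r (s ∷ xs) (farFromFirstPath? G v l) bound
      wilson-far-≤ N with s ∈? r ∷ []
      ... | yes (here s≡r) = contradiction s≡r s≢r
      ... | no s∉          = first-walk-≤ N refl (path-[-] s∉)

-- The cylinder

-- By Bernoulli's inequality, θ ^ K ≥ 1 - δ for θ = 1 - δ / K.
module Decay (K′ : ℕ) (1≤K′ : 1 ℕ.≤ K′) (δ : ℚ) (0<δ : 0ℚ < δ) (δ≤1 : δ ≤ 1ℚ) where

  private
    K = suc K′
    2ℚ = 1ℚ + 1ℚ

    η : ℚ
    η = ℤ.+ 1 / K * δ

    K·η≡δ : K · η ≡ δ
    K·η≡δ = trans (sym (·-assoc-* K (ℤ.+ 1 / K) δ)) (trans (cong (_* δ) (suc·1/suc K′)) (*-identityˡ δ))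

    0<η : 0ℚ < η
    0<η = subst (_< η) (*-zeroʳ (ℤ.+ 1 / K)) (*-monoʳ-<-pos (ℤ.+ 1 / K) {{positive (1/suc>0 K′)}} 0<δ)

    η≥0 : η ≥0
    η≥0 = <⇒≤ 0<η

    multiple≤1 : ∀ {j} → j ℕ.≤ K → j · η ≤ 1ℚ
    multiple≤1 j≤K = ≤-trans (·-mono η≥0 j≤K) (subst (_≤ 1ℚ) (sym K·η≡δ) δ≤1)

    η≤1 : η ≤ 1ℚ
    η≤1 = subst (_≤ 1ℚ) (+-identityʳ η) (multiple≤1 (s≤s z≤n))

  θ : ℚ
  θ = 1ℚ - η

  -- Chosen to absorb the `2 K` powers of `θ` by which `(2 + w) * K` exceeds `w * K`, using
  -- `2 θ ≥ 1`.
  C : ℚ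
  C = 2ℚ ^ (2 ℕ.* K)

  1≤2θ : 1ℚ ≤ 2ℚ * θ
  1≤2θ = begin
    1ℚ                        ≡⟨ +-identityʳ 1ℚ ⟨
    -- As `K` is at least 2, `2 · η ≤ K · η = δ ≤ 1`.
    1ℚ + 0ℚ                   ≤⟨ +-monoʳ-≤ 1ℚ (-≥0 (multiple≤1 (s≤s 1≤K′))) ⟩
    1ℚ + (1ℚ - 2 · η)         ≡⟨ solve 1 (λ x → con 1ℚ :+ (con 1ℚ :- (x :+ (x :+ con 0ℚ))) := con 2ℚ :* (con 1ℚ :- x)) refl η ⟩
    2ℚ * θ                    ∎
    where
    open ≤-Reasoning
    open +-*-Solver

  0<θ : 0ℚ < θ
  0<θ = *-cancelˡ-<-nonNeg 2ℚ (<-≤-trans (positive⁻¹ 1ℚ) 1≤2θ)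

  θ<1 : θ < 1ℚ
  θ<1 = subst (θ <_) (+-identityʳ 1ℚ) (+-monoʳ-< 1ℚ (neg-antimono-< 0<η))

  decay : ∀ w l → l ℕ.≤ (2 ℕ.+ w) ℕ.* K → (1ℚ - δ) ^ w ≤ C * θ ^ l
  decay w l l≤ = begin
    (1ℚ - δ) ^ w                                  ≤⟨ ^-mono w (-≥0 δ≤1) 1-δ≤θ^K ⟩
    (θ ^ K) ^ w                                   ≡⟨ *-identityˡ _ ⟨
    1ℚ * (θ ^ K) ^ w                              ≤⟨ *-monoʳ (^-≥0 w (^-≥0 K θ≥0)) (^-≥1 (2 ℕ.* K) 1≤2θ) ⟩
    (2ℚ * θ) ^ (2 ℕ.* K) * (θ ^ K) ^ w            ≡⟨ cong₂ _*_ (^-distrib-* 2ℚ θ (2 ℕ.* K)) (sym (^-* θ K w)) ⟩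
    C * θ ^ (2 ℕ.* K) * θ ^ (w ℕ.* K)             ≡⟨ *-assoc C (θ ^ (2 ℕ.* K)) (θ ^ (w ℕ.* K)) ⟩
    C * (θ ^ (2 ℕ.* K) * θ ^ (w ℕ.* K))           ≡⟨ cong (C *_) (^-+ θ (2 ℕ.* K) (w ℕ.* K)) ⟨
    C * θ ^ (2 ℕ.* K ℕ.+ w ℕ.* K)                 ≡⟨ cong (λ j → C * θ ^ j) (ℕₚ.*-distribʳ-+ K 2 w) ⟨
    C * θ ^ ((2 ℕ.+ w) ℕ.* K)                     ≤⟨ *-monoˡ (^-≥0 (2 ℕ.* K) (+≥0 1≥0 1≥0)) (^-antimono θ≥0 (<⇒≤ θ<1) l≤) ⟩
    C * θ ^ l                                     ∎
    where
    open ≤-Reasoning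
    θ≥0 : θ ≥0
    θ≥0 = <⇒≤ 0<θ
    1-δ≤θ^K : 1ℚ - δ ≤ θ ^ K
    1-δ≤θ^K = subst (λ x → 1ℚ - x ≤ θ ^ K) K·η≡δ (bernoulli K η≥0 η≤1)

^-positive : ∀ {p} k → 0ℚ < p → 0ℚ < p ^ k
^-positive     zero    0<p = positive⁻¹ 1ℚ
^-positive {p} (suc k) 0<p = subst (_< p * p ^ k) (*-zeroʳ p) (*-monoʳ-<-pos p {{positive 0<p}} (^-positive k 0<p))

-- The levels are shifted by o, so that the w ≤ o levels below any vertex exist.
module Cylinder (n′ m o : ℕ) where

  private
    n = suc n′

  label : Cyl n m → ℕ
  label (_ , j) = toℕ j ℕ.+ o

  position : ℕ → Fin n
  position x = fromℕ< (ℕ.m%n<n x n)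

  toℕ-position : ∀ x → toℕ (position x) ≡ x ℕ.% n
  toℕ-position x = toℕ-fromℕ< (ℕ.m%n<n x n)

  next : Cyl n m → Cyl n m
  next (i , j) = position (suc (toℕ i)) , j

  ~-label : ∀ {u w} → CylAdj u w → label w ℕ.≤ suc (label u)
  ~-label (inj₁ (refl , _))      = ℕₚ.n≤1+n _
  ~-label (inj₂ (_ , inj₁ up))   = ℕₚ.≤-reflexive (cong (ℕ._+ o) up)
  ~-label (inj₂ (_ , inj₂ down)) = ℕₚ.≤-trans (ℕₚ.n≤1+n _) (ℕₚ.≤-trans (ℕₚ.≤-reflexive (cong (ℕ._+ o) (sym down))) (ℕₚ.n≤1+n _))

  ~-next : ∀ u → CylAdj u (next u)
  ~-next (i , j) = inj₁ (refl , inj₁ (toℕ-position (suc (toℕ i))))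

  position-toℕ : ∀ i → position (toℕ i) ≡ i
  position-toℕ i = toℕ-injective (trans (toℕ-position (toℕ i)) (ℕ.m<n⇒m%n≡m (toℕ<n i)))

  position-suc : ∀ x → position (suc (toℕ (position x))) ≡ position (suc x)
  position-suc x = toℕ-injective (begin
    toℕ (position (suc (toℕ (position x))))   ≡⟨ toℕ-position (suc (toℕ (position x))) ⟩
    suc (toℕ (position x)) ℕ.% n              ≡⟨ cong (λ y → suc y ℕ.% n) (toℕ-position x) ⟩
    suc (x ℕ.% n) ℕ.% n                       ≡⟨ ℕ.%-distribˡ-+ 1 (x ℕ.% n) n ⟩
    (1 ℕ.% n ℕ.+ x ℕ.% n ℕ.% n) ℕ.% n         ≡⟨ cong (λ y → (1 ℕ.% n ℕ.+ y) ℕ.% n) (ℕ.m%n%n≡m%n x n) ⟩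
    (1 ℕ.% n ℕ.+ x ℕ.% n) ℕ.% n               ≡⟨ ℕ.%-distribˡ-+ 1 x n ⟨
    suc x ℕ.% n                               ≡⟨ toℕ-position (suc x) ⟨
    toℕ (position (suc x))                    ∎)
    where open ≡-Reasoning

  orbit : ∀ (P : Pred (Cyl n m) 0ℓ) → (∀ {u} → P u → P (next u)) → ∀ {u w} → label u ≡ label w → P u → P w
  orbit P P-next {i , j} {i′ , j′} ℓ Pu with refl ← toℕ-injective (ℕₚ.+-cancelʳ-≡ o (toℕ j) (toℕ j′) ℓ) =
    -- From `i`, the first `n - i` rotations lead to position 0 and the other `i′` to `i′`.
    subst (λ i → P (i , j)) reach (rotate (n ℕ.∸ toℕ i ℕ.+ toℕ i′))
    where
    rotate : ∀ k → P (position (k ℕ.+ toℕ i) , j)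
    rotate zero    = subst (λ i → P (i , j)) (sym (position-toℕ i)) Pu
    rotate (suc k) = subst (λ i → P (i , j)) (position-suc (k ℕ.+ toℕ i)) (P-next (rotate k))
    reach : position (n ℕ.∸ toℕ i ℕ.+ toℕ i′ ℕ.+ toℕ i) ≡ i′
    reach = toℕ-injective (begin
      toℕ (position (n ℕ.∸ toℕ i ℕ.+ toℕ i′ ℕ.+ toℕ i))   ≡⟨ toℕ-position (n ℕ.∸ toℕ i ℕ.+ toℕ i′ ℕ.+ toℕ i) ⟩
      (n ℕ.∸ toℕ i ℕ.+ toℕ i′ ℕ.+ toℕ i) ℕ.% n            ≡⟨ cong (ℕ._% n) (ℕSolver.solve 3 (λ a b c → a :+ b :+ c := b :+ (a :+ c)) refl (n ℕ.∸ toℕ i) (toℕ i′) (toℕ i)) ⟩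
      (toℕ i′ ℕ.+ (n ℕ.∸ toℕ i ℕ.+ toℕ i)) ℕ.% n          ≡⟨ cong (λ x → (toℕ i′ ℕ.+ x) ℕ.% n) (ℕₚ.m∸n+n≡m (ℕₚ.<⇒≤ (toℕ<n i))) ⟩
      (toℕ i′ ℕ.+ n) ℕ.% n                                ≡⟨ ℕ.[m+n]%n≡m%n (toℕ i′) n ⟩
      toℕ i′ ℕ.% n                                        ≡⟨ ℕ.m<n⇒m%n≡m (toℕ<n i′) ⟩
      toℕ i′                                              ∎)
      where
      open ≡-Reasoning
      open ℕSolver using (_:+_; _:=_)

  length-cartesianProduct : ∀ {A B : Set} (xs : List A) (ys : List B) →
    length (cartesianProduct xs ys) ≡ length xs ℕ.* length ys
  length-cartesianProduct []       ys = refl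
  length-cartesianProduct (x ∷ xs) ys = trans (length-++ (map (x ,_) ys))
    (cong₂ ℕ._+_ (length-map (x ,_) ys) (length-cartesianProduct xs ys))

  -- Column and label determine a vertex, so the window embeds into a grid of `n` columns and `w`
  -- labels.
  windowSize : ∀ a w {q : List (Cyl n m)} → Unique q → (∀ {u} → u ∈ q → a ℕ.≤ label u × label u ℕ.< a ℕ.+ w) →
               length q ℕ.≤ w ℕ.* n
  windowSize a w {q} !q inWindow = begin
    length q                                              ≡⟨ length-map coordinates q ⟨
    length (map coordinates q)                            ≤⟨ unique-⊆⇒length-≤ (Unique.map⁺ coordinates-injective !q) coordinates-∈ ⟩
    length (cartesianProduct (allFin n) (map (a ℕ.+_) (upTo w)))
      ≡⟨ length-cartesianProduct (allFin n) (map (a ℕ.+_) (upTo w)) ⟩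
    length (allFin n) ℕ.* length (map (a ℕ.+_) (upTo w))
      ≡⟨ cong₂ ℕ._*_ (length-tabulate {n = n} (λ i → i)) (trans (length-map (a ℕ.+_) (upTo w)) (length-upTo w)) ⟩
    n ℕ.* w                                               ≡⟨ ℕₚ.*-comm n w ⟩
    w ℕ.* n                                               ∎
    where
    open ℕₚ.≤-Reasoning
    coordinates : Cyl n m → Fin n × ℕ
    coordinates u = proj₁ u , label u
    coordinates-injective : ∀ {u w} → coordinates u ≡ coordinates w → u ≡ w
    coordinates-injective {i , j} {i′ , j′} eq =
      cong₂ _,_ (cong proj₁ eq) (toℕ-injective (ℕₚ.+-cancelʳ-≡ o (toℕ j) (toℕ j′) (cong proj₂ eq)))
    coordinates-∈ : ∀ {c} → c ∈ map coordinates q → c ∈ cartesianProduct (allFin n) (map (a ℕ.+_) (upTo w))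
    coordinates-∈ c∈ with u , u∈ , refl ← ∈-map⁻ coordinates c∈ with a≤ , <a+w ← inWindow u∈ =
      ∈-cartesianProduct⁺ (∈-allFin (proj₁ u)) (subst (_∈ map (a ℕ.+_) (upTo w)) (ℕₚ.m+[n∸m]≡n a≤)
        (∈-map⁺ (a ℕ.+_) (∈-upTo⁺ (ℕₚ.+-cancelˡ-< a _ _ (subst (ℕ._< a ℕ.+ w) (sym (ℕₚ.m+[n∸m]≡n a≤)) <a+w)))))

  rings : Rings (cylinder n m)
  rings = record
    { n′         = n′
    ; label      = label
    ; next       = next
    ; ~-label    = ~-label
    ; ~-next     = ~-next
    ; label-next = λ _ → refl
    ; orbit      = orbit
    ; windowSize = windowSize
    }

  open Blocking (cylinder n m) rings public

-- Opposite boundary rings and the choice of constants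

opposite-≢ : ∀ {n m} {r s : Cyl n m} → 2 ℕ.≤ m → OppositeBoundaryRings r s → s ≢ r
opposite-≢ (s≤s (s≤s _)) (inj₁ (r₀ , s₁)) refl with () ← trans (sym r₀) s₁
opposite-≢ (s≤s (s≤s _)) (inj₂ (r₁ , s₀)) refl with () ← trans (sym s₀) r₁

opposite-between : ∀ n′ {m} o {r s : Cyl (suc n′) m} → OppositeBoundaryRings r s →
                   ∀ u → Cylinder.FirstWalk.Between n′ m o r s (Cylinder.label n′ m o u) r
opposite-between n′ {suc m} o {r} {s} opp (i , j) with ℕₚ.≤-pred (toℕ<n j) | opp
... | j≤m | inj₁ (r₀ , s₁) = inj₂
  ( ℕₚ.+-monoˡ-≤ o (subst (ℕ._≤ toℕ j) (sym r₀) z≤n)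
  , ℕₚ.+-monoˡ-≤ o (subst (toℕ j ℕ.≤_) (sym s₁) j≤m) )
... | j≤m | inj₂ (r₁ , s₀) = inj₁
  ( ℕₚ.+-monoˡ-≤ o (subst (ℕ._≤ toℕ j) (sym s₀) z≤n)
  , ℕₚ.+-monoˡ-≤ o (subst (toℕ j ℕ.≤_) (sym r₁) j≤m) )

mainTheorem4 : ∀ (n : ℕ) → 3 ℕ.≤ n →
    Σ[ C ∈ ℚ ] Σ[ θ ∈ ℚ ] 0ℚ < θ × θ < 1ℚ ×
    (∀ (m : ℕ) → 2 ℕ.≤ m →
    ∀ (r s : Cyl n m) (xs : List (Cyl n m)) →
    OppositeBoundaryRings r s →
    IsOrdering (cylinder n m) r (s ∷ xs) →
    ∀ (v : Cyl n m) (l : ℕ) →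
    ℙWilson≤ (cylinder n m) r (s ∷ xs)
    (farFromFirstPath? (cylinder n m) v l)
    (C * θ ^ l))
mainTheorem4 (suc n′) _ = C + C , θ , 0<θ , θ<1 , λ m 2≤m r s xs opp ordering v l N →
  -- For positive `w` this gives `(2 w + 1) n ≤ q K ≤ l`, and always `l ≤ (2 + w) K`. Truncation
  -- makes `w = 0` when `l < 2 K`. Shifting the labels by `w` makes room for the lower block, and
  -- `C + C` collects one term per block.
  let q = l ℕ./ K
      w = q ℕ.∸ 1
  in ≤-trans
    (Cylinder.FirstWalk.wilson-far-≤ n′ m w r s v l w (ℕₚ.m≤n+m w _) (size l)
      (opposite-≢ {r = r} {s} 2≤m opp) (opposite-between n′ w {r} {s} opp) xs (λ u → ∈-resp-↭ (↭-sym ordering) (FiniteGraph.complete (cylinder n m) u)) N)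
    (≤-trans (+-mono-≤ (decay w l (length-≤ l)) (decay w l (length-≤ l))) (≤-reflexive (sym (*-distribʳ-+ (θ ^ l) C C))))
  where
  n = suc n′
  K = 2 ℕ.* n
  ε = ℤ.+ 1 / (3 ℕ.* n)
  ε>0 : 0ℚ < ε
  ε>0 = 1/suc>0 (n′ ℕ.+ 2 ℕ.* n)
  -- The first argument is the predecessor of `K = 2 n`. With `δ = ε ^ n`, `1 - δ` is the initial
  -- bound on each factor.
  open Decay (n′ ℕ.+ 1 ℕ.* n) (ℕₚ.≤-trans (ℕₚ.m≤m+n 1 (n′ ℕ.+ 0)) (ℕₚ.m≤n+m (1 ℕ.* n) n′))
    (ε ^ n) (^-positive n ε>0) (^-≤1 n (<⇒≤ ε>0) (1/suc≤1 (n′ ℕ.+ 2 ℕ.* n)))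
  size : ∀ l → 0 ℕ.< l ℕ./ K ℕ.∸ 1 → (2 ℕ.* (l ℕ./ K ℕ.∸ 1) ℕ.+ 1) ℕ.* n ℕ.≤ l
  size l 0<w with l ℕ./ K | ℕ.m/n*n≤m l K
  ... | suc w | Kq≤l = begin
    (2 ℕ.* w ℕ.+ 1) ℕ.* n   ≤⟨ ℕₚ.*-monoˡ-≤ n (ℕₚ.+-monoʳ-≤ (2 ℕ.* w) (ℕₚ.n≤1+n 1)) ⟩
    (2 ℕ.* w ℕ.+ 2) ℕ.* n   ≡⟨ ℕSolver.solve 2 (λ w n → (con 2 :* w :+ con 2) :* n := (con 1 :+ w) :* (con 2 :* n)) refl w n ⟩
    suc w ℕ.* K             ≤⟨ Kq≤l ⟩
    l                       ∎
    where
    open ℕₚ.≤-Reasoning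
    open ℕSolver using (con; _:+_; _:*_; _:=_)
  length-≤ : ∀ l → l ℕ.≤ (2 ℕ.+ (l ℕ./ K ℕ.∸ 1)) ℕ.* K
  length-≤ l = begin
    l                                    ≡⟨ ℕ.m≡m%n+[m/n]*n l K ⟩
    l ℕ.% K ℕ.+ l ℕ./ K ℕ.* K            ≤⟨ ℕₚ.+-mono-≤ (ℕₚ.<⇒≤ (ℕ.m%n<n l K)) (ℕₚ.*-monoˡ-≤ K (ℕₚ.m≤n+m∸n (l ℕ./ K) 1)) ⟩
    (2 ℕ.+ (l ℕ./ K ℕ.∸ 1)) ℕ.* K        ∎
    where open ℕₚ.≤-Reasoning
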